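{- Let $G$ be a cycle of length $L>0$, regarded as a metric graph, and let $w\ge 1$ be an integer. The minimum of $\mathrm{diam}(G')$ over all metric graphs $G'$ obtained from $G$ by the fusion of $w+1$ distinct points of $G$ (that is, identifying these $w+1$ points to a single point) is equal to $L/(w+1)$.
   Context: A metric graph is a finite edge-weighted graph regarded as a metric space in which all points in the interior of each edge are included and each edge is locally isometric to an interval whose length is the edge weight; $\mathrm{diam}(G)=\max_{x,y\in G} d_G(x,y)$ over all points of $G$, where $d_G(x,y)$ is the minimum length of a path from $x$ to $y$. The points to be fused may be arbitrary points of the cycle. -}

module Defs where

open import Level using (0ℓ)
open import Algebra.Bundles using (CommutativeRing)
import Algebra.Definitions.RawMonoid as RawMonoidOps
open import Data.Bool.Base using (if_then_else_)
open import Data.Fin.Base using (Fin; zero; suc; toℕ)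
open import Data.List.Base using (List; []; _++_; tabulate)
open import Data.List.Membership.Propositional using (_∈_)
open import Data.Nat.Base using (ℕ; suc)
open import Data.Nat.DivMod using (_mod_)
open import Data.Product.Base using (Σ-syntax; ∃; ∃-syntax; _×_; _,_)
open import Relation.Binary.Construct.Closure.Equivalence using (EqClosure)
import Relation.Binary.Construct.NonStrictToStrict as ToStrict
open import Relation.Binary.Core using (Rel)
open import Relation.Binary.PropositionalEquality.Core using (_≢_)
open import Relation.Binary.Structures using (IsDecTotalOrder)
open import Relation.Nullary.Decidable.Core using (does)
open import Relation.Nullary.Negation.Core using (¬_)
open import Relation.Unary using (Pred)

-- The standard library has no real numbers.  They are taken here to be any
-- Dedekind-complete totally ordered field (classically unique up to a unique
-- isomorphism), with the order decidable as it is in classical mathematics.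

record Reals : Set₁ where
  infix  4 _≤_
  infixl 7 _/_
  infix  8 _⁻¹

  field
    commutativeRing : CommutativeRing 0ℓ 0ℓ

  open CommutativeRing commutativeRing public
    renaming (Carrier to ℝ) hiding (zero)

  field
    0≉1             : ¬ (0# ≈ 1#)
    -- The value at 0 is unspecified.
    _⁻¹             : ℝ → ℝ
    *-inverseʳ      : ∀ x → ¬ (x ≈ 0#) → x * x ⁻¹ ≈ 1#

    _≤_             : Rel ℝ 0ℓ
    isDecTotalOrder : IsDecTotalOrder _≈_ _≤_
    +-monoˡ-≤       : ∀ {x y} z → x ≤ y → x + z ≤ y + z
    *-nonNegative   : ∀ {x y} → 0# ≤ x → 0# ≤ y → 0# ≤ x * y

  UpperBound : Pred ℝ 0ℓ → Pred ℝ 0ℓ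
  UpperBound P b = ∀ x → P x → x ≤ b

  field
    supremum : (P : Pred ℝ 0ℓ) → ∃ P → ∃ (UpperBound P) →
               ∃[ s ] UpperBound P s × (∀ b → UpperBound P b → s ≤ b)

  open IsDecTotalOrder isDecTotalOrder public using (_≤?_)
  open ToStrict _≈_ _≤_ public using (_<_)
  open RawMonoidOps +-rawMonoid public using (sum)

  fromℕ : ℕ → ℝ
  fromℕ n = n RawMonoid.× 1#
    where module RawMonoid = RawMonoidOps +-rawMonoid

  _/_ : ℝ → ℝ → ℝ
  x / y = x * y ⁻¹

  ∣_∣ : ℝ → ℝ
  ∣ x ∣ = if does (0# ≤? x) then x else - x


module MetricGraphs (R : Reals) where
  open Reals R

  -- Loops and multiple edges are allowed.
  record WeightedGraph : Set where
    field
      #vertices  : ℕ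
      #edges     : ℕ
      source     : Fin #edges → Fin #vertices
      target     : Fin #edges → Fin #vertices
      weight     : Fin #edges → ℝ
      weight>0   : ∀ e → 0# < weight e

  -- The disjoint union of the vertices and of one closed interval
  -- [0 , weight e] for each edge e, before any identification.
  data Point (Γ : WeightedGraph) : Set where
    vertex : Fin (WeightedGraph.#vertices Γ) → Point Γ
    on     : (e : Fin (WeightedGraph.#edges Γ)) (t : ℝ) →
             0# ≤ t → t ≤ WeightedGraph.weight Γ e → Point Γ

  -- A weighted graph in which finitely many pairs of points, not necessarily
  -- vertices, are identified.  (Subdividing the edges at the identified points
  -- turns this into a graph whose vertices only are identified, so that these
  -- are exactly the metric graphs.)  A weighted graph itself has glued = [].
  record MetricGraph : Set where
    field
      graph : WeightedGraph
      glued : List (Point graph × Point graph)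
    open WeightedGraph graph public

  open MetricGraph

  data Identified (G : MetricGraph) : Rel (Point (graph G)) 0ℓ where
    sameParameter : ∀ {e s t 0≤s s≤w 0≤t t≤w} → s ≈ t →
                    Identified G (on e s 0≤s s≤w) (on e t 0≤t t≤w)
    atSource      : ∀ {e t 0≤t t≤w} → t ≈ 0# →
                    Identified G (on e t 0≤t t≤w) (vertex (source G e))
    atTarget      : ∀ {e t 0≤t t≤w} → t ≈ weight G e →
                    Identified G (on e t 0≤t t≤w) (vertex (target G e))
    gluing        : ∀ {x y} → (x , y) ∈ glued G → Identified G x y

  -- Equality of points of the metric graph.
  SamePoint : (G : MetricGraph) → Rel (Point (graph G)) 0ℓ
  SamePoint G = EqClosure (Identified G)

  -- Paths are finite concatenations of segments of edges, traversed in either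
  -- direction.
  data Path (G : MetricGraph) : Rel (Point (graph G)) 0ℓ where
    stay : ∀ {x y} → SamePoint G x y → Path G x y
    move : ∀ {x y} e s t {0≤s s≤w 0≤t t≤w} →
           SamePoint G x (on e s 0≤s s≤w) →
           Path G (on e t 0≤t t≤w) y → Path G x y

  length : ∀ {G x y} → Path G x y → ℝ
  length (stay _)         = 0#
  length (move _ s t _ γ) = ∣ t - s ∣ + length γ

  -- d is the minimum of the lengths of the paths from x to y.
  IsDistance : (G : MetricGraph) → (x y : Point (graph G)) → ℝ → Set
  IsDistance G x y d = (Σ[ γ ∈ Path G x y ] length γ ≈ d)
                     × (∀ (γ : Path G x y) → d ≤ length γ)

  -- D is the maximum of the distances; in particular all distances exist.
  IsDiameter : MetricGraph → ℝ → Set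
  IsDiameter G D = (∃[ x ] ∃[ y ] IsDistance G x y D)
                 × (∀ x y → ∃[ d ] IsDistance G x y d × d ≤ D)

  Distinct : (G : MetricGraph) → ∀ {n} → (Fin n → Point (graph G)) → Set
  Distinct G p = ∀ i j → i ≢ j → ¬ SamePoint G (p i) (p j)

  fuse : (G : MetricGraph) → ∀ {w} → (Fin (suc w) → Point (graph G)) → MetricGraph
  fuse G p = record
    { graph = graph G
    ; glued = tabulate (λ i → p zero , p i) ++ glued G
    }

  -- m is the minimum of diam G′ over the G′ obtained from G by fusing w + 1
  -- distinct points; in particular every such G′ has a diameter.
  IsMinimumFusedDiameter : MetricGraph → ℕ → ℝ → Set
  IsMinimumFusedDiameter G w m =
      (Σ[ p ∈ (Fin (suc w) → Point (graph G)) ]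
         Distinct G p × IsDiameter (fuse G p) m)
    × (∀ (p : Fin (suc w) → Point (graph G)) → Distinct G p →
         ∃[ D ] IsDiameter (fuse G p) D × m ≤ D)

  -- A cycle with k + 1 vertices and k + 1 edges, the edge i joining the vertex
  -- i to the vertex i + 1 modulo k + 1; for k = 0 this is a single loop.
  record Cycle (L : ℝ) : Set where
    field
      k           : ℕ
      edgeLength  : Fin (suc k) → ℝ
      positive    : ∀ i → 0# < edgeLength i
      totalLength : sum edgeLength ≈ L

    metricGraph : MetricGraph
    metricGraph = record
      { graph = record
        { #vertices = suc k
        ; #edges    = suc k
        ; source    = λ i → i
        ; target    = λ i → suc (toℕ i) mod suc k
        ; weight    = edgeLength
        ; weight>0  = positive
        }
      ; glued = []
      }

{-# OPTIONS --safe #-}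
-- Fusing w + 1 points turns the cycle into a bouquet of w + 1 loops, the gaps
-- between consecutive points.  The distance of x and y after the fusion is the
-- smaller of their distance on the cycle and the sum of their distances
-- ("heights") to the fused points; that no path is shorter holds because this
-- expression is 1-Lipschitz in x along every edge and compatible with all the
-- identifications.  A loop of length a contains no points higher than a / 2,
-- and its middle has this height, so the diameter is the maximum of a / 2 + b / 2
-- over two different loops.  The average of a / 2 + b / 2 over the w + 1 pairs of
-- cyclically consecutive loops is L / (w + 1), a lower bound for the maximum,
-- with equality if all loops are equally long.
module Submission where

open import Defs
import Algebra.Construct.NaturalChoice.Min as NaturalChoiceMin
import Algebra.Properties.Ring as RingProperties
import Algebra.Properties.Semiring.Mult as SemiringMult
import Algebra.Solver.Ring as RingSolver
open import Algebra.Solver.Ring.AlmostCommutativeRing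
  using (_-Raw-AlmostCommutative⟶_; fromCommutativeRing)
import Data.Fin.Base as Fin
open import Data.Fin.Base using (Fin; zero; suc; toℕ; fromℕ<)
open import Data.Fin.Properties using (toℕ-fromℕ; toℕ-fromℕ<; toℕ-injective; toℕ<n)
import Data.Integer.Base as ℤ
import Data.Integer.Properties as ℤ
open import Data.List.Base as List
  using (List; []; _∷_; _++_; allFin; cartesianProduct; tabulate)
import Data.List.Extrema as Extrema
open import Data.List.Membership.Propositional using (_∈_)
open import Data.List.Membership.Propositional.Properties
  using (∈-allFin; ∈-++⁺ˡ; ∈-++⁻; ∈-cartesianProduct⁺; ∈-tabulate⁺; ∈-tabulate⁻)
open import Data.List.Properties using (length-map; length-tabulate)
open import Data.List.Relation.Binary.Permutation.Propositional using (↭-sym)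
open import Data.List.Relation.Binary.Permutation.Propositional.Properties
  using (↭-length; ∈-resp-↭)
import Data.List.Relation.Unary.All as All
open import Data.List.Relation.Unary.Any using (here; there)
open import Data.List.Relation.Unary.Linked using (Linked; [-]; _∷_)
import Data.List.Sort as Sort
open import Data.Maybe.Base using (Maybe; just; nothing)
open import Data.Nat.Base as ℕ using (ℕ; zero; suc)
open import Data.Nat.DivMod
  using (_mod_; _%_; m%n<n; m<n⇒m%n≡m; m%n%n≡m%n; n%n≡0; [m+n]%n≡m%n; %-distribˡ-+)
import Data.Nat.Properties as ℕ
open import Data.Product.Base using (Σ-syntax; ∃-syntax; _×_; _,_; proj₁; proj₂)
open import Data.Sum.Base using (_⊎_; inj₁; inj₂; [_,_]′)
open import Function.Base using (_∘_; _⟨_⟩_)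
open import Level using (0ℓ)
open import Relation.Binary.Bundles using (DecTotalOrder)
import Relation.Binary.Construct.Closure.Equivalence as Eq
import Relation.Binary.Construct.On as On
open import Relation.Binary.Definitions using (tri<; tri≈; tri>)
open import Relation.Binary.PropositionalEquality as ≡ using (_≡_; _≢_)
import Relation.Binary.Reasoning.Setoid as SetoidReasoning
open import Relation.Nullary using (¬_; yes; no; contradiction)

-- Comparing gaps requires a cyclic order of the fused points, and the gap that passes the vertex 0
-- fits no linear order. The cycle is therefore unrolled: a point gets a position between 0 and `L`,
-- and the gap across the seam is treated like the others by also allowing positions one turn `L`
-- later. The theorem includes the existence of the diameter after every fusion, so bounds do not
-- suffice. The exact distance is needed with a path that attains it, and so is a pair of points
-- that attains the maximum. Pairs of gaps provide this: they are finitely many, and each has a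
-- largest distance that is attained. All computations with gaps start from an abstract
-- `Enumeration`. Arbitrary points obtain one by sorting. The equally spaced points get an explicit
-- one, so that their gaps are known without following the sorting algorithm. For `w = 1` the two
-- cyclically consecutive pairs are the same pair of loops, counted twice.

nth : ∀ {A : Set} → A → List A → ℕ → A
nth d []       i       = d
nth d (x ∷ xs) zero    = x
nth d (x ∷ xs) (suc i) = nth d xs i

nth-length : ∀ {A : Set} (d : A) xs → nth d xs (List.length xs) ≡ d
nth-length d []       = ≡.refl
nth-length d (x ∷ xs) = nth-length d xs

∈⇒nth : ∀ {A : Set} (d : A) {x xs} → x ∈ xs → ∃[ i ] i ℕ.< List.length xs × nth d xs i ≡ x
∈⇒nth d (here ≡.refl) = 0 , ℕ.s≤s ℕ.z≤n , ≡.refl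
∈⇒nth d (there x∈xs)  = let i , i< , eq = ∈⇒nth d x∈xs in suc i , ℕ.s≤s i< , eq

mod-toℕ : ∀ {m} (i : Fin (suc m)) → toℕ i mod suc m ≡ i
mod-toℕ i = toℕ-injective (≡.trans (toℕ-fromℕ< _) (m<n⇒m%n≡m (toℕ<n i)))

-- Arithmetic in an ordered field

module RealProperties (R : Reals) where
  open Reals R public
  open RingProperties ring using (-‿+-comm; -‿distribˡ-*; -‿distribʳ-*; -‿involutive; -0#≈0#)
  open SemiringMult semiring using (×-homo-+; ×1-homo-*) renaming (_×_ to _·_)

  decTotalOrder : DecTotalOrder 0ℓ 0ℓ 0ℓ
  decTotalOrder = record { isDecTotalOrder = isDecTotalOrder }

  open DecTotalOrder decTotalOrder public
    using (total; antisym; totalOrder)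
    renaming (refl to ≤-refl; trans to ≤-trans; reflexive to ≤-reflexive; _≟_ to _≈?_)
  private
    module Min = NaturalChoiceMin totalOrder

  infixl 7 _⊓_

  -- Opaque, as is arc below: unfolding their case distinctions makes
  -- conversion checking infeasible.
  opaque
    _⊓_ : ℝ → ℝ → ℝ
    _⊓_ = Min._⊓_

    x⊓y≤x : ∀ x y → x ⊓ y ≤ x
    x⊓y≤x = Min.x⊓y≤x

    x⊓y≤y : ∀ x y → x ⊓ y ≤ y
    x⊓y≤y = Min.x⊓y≤y

    ⊓-glb : ∀ {x y z} → x ≤ y → x ≤ z → x ≤ y ⊓ z
    ⊓-glb = Min.⊓-glb

    ⊓-sel : ∀ x y → x ⊓ y ≈ x ⊎ x ⊓ y ≈ y
    ⊓-sel = Min.⊓-sel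

    ⊓-cong : ∀ {x y u v} → x ≈ y → u ≈ v → x ⊓ u ≈ y ⊓ v
    ⊓-cong = Min.⊓-cong

    ⊓-comm : ∀ x y → x ⊓ y ≈ y ⊓ x
    ⊓-comm = Min.⊓-comm

  -- Unlike the carrier, the integer coefficients have an equality test that
  -- computes, so that the solver can cancel.
  module IntegerCoefficients where
    open SetoidReasoning setoid

    fromℤ : ℤ.ℤ → ℝ
    fromℤ (ℤ.+ n)    = n · 1#
    fromℤ ℤ.-[1+ n ] = - (suc n · 1#)

    fromℤ-cong : ∀ {i j} → i ≡ j → fromℤ i ≈ fromℤ j
    fromℤ-cong ≡.refl = refl

    fromℤ-neg : ∀ i → fromℤ (ℤ.- i) ≈ - fromℤ i
    fromℤ-neg (ℤ.+ zero)  = sym -0#≈0#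
    fromℤ-neg (ℤ.+ suc n) = refl
    fromℤ-neg ℤ.-[1+ n ]  = sym (-‿involutive _)

    fromℤ-⊖ : ∀ m n → fromℤ (m ℤ.⊖ n) ≈ m · 1# - n · 1#
    fromℤ-⊖ m zero = begin
      m · 1#       ≈⟨ +-identityʳ _ ⟨
      m · 1# + 0#  ≈⟨ +-congˡ -0#≈0# ⟨
      m · 1# - 0#  ∎
    fromℤ-⊖ zero (suc n) = sym (+-identityˡ _)
    fromℤ-⊖ (suc m) (suc n) = begin
      fromℤ (suc m ℤ.⊖ suc n)                   ≈⟨ fromℤ-cong (ℤ.[1+m]⊖[1+n]≡m⊖n m n) ⟩
      fromℤ (m ℤ.⊖ n)                           ≈⟨ fromℤ-⊖ m n ⟩
      m · 1# - n · 1#                           ≈⟨ +-congʳ (+-identityˡ _) ⟨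
      0# + m · 1# - n · 1#                      ≈⟨ +-congʳ (+-congʳ (-‿inverseʳ 1#)) ⟨
      1# - 1# + m · 1# - n · 1#                 ≈⟨ +-congʳ (+-assoc _ _ _) ⟩
      1# + (- 1# + m · 1#) - n · 1#             ≈⟨ +-congʳ (+-congˡ (+-comm _ _)) ⟩
      1# + (m · 1# - 1#) - n · 1#               ≈⟨ +-congʳ (+-assoc _ _ _) ⟨
      1# + m · 1# - 1# - n · 1#                 ≈⟨ +-assoc _ _ _ ⟩
      1# + m · 1# + (- 1# - n · 1#)             ≈⟨ +-congˡ (-‿+-comm _ _) ⟩
      1# + m · 1# - (1# + n · 1#)               ∎

    fromℤ-+ : ∀ i j → fromℤ (i ℤ.+ j) ≈ fromℤ i + fromℤ j
    fromℤ-+ (ℤ.+ m)    (ℤ.+ n)    = ×-homo-+ 1# m n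
    fromℤ-+ (ℤ.+ m)    ℤ.-[1+ n ] = fromℤ-⊖ m (suc n)
    fromℤ-+ ℤ.-[1+ m ] (ℤ.+ n)    = trans (fromℤ-⊖ n (suc m)) (+-comm _ _)
    fromℤ-+ ℤ.-[1+ m ] ℤ.-[1+ n ] = begin
      fromℤ (ℤ.-[1+ m ] ℤ.+ ℤ.-[1+ n ])       ≈⟨ fromℤ-cong (≡.sym (ℤ.neg-distrib-+ (ℤ.+ suc m) (ℤ.+ suc n))) ⟩
      - ((suc m ℕ.+ suc n) · 1#)              ≈⟨ -‿cong (×-homo-+ 1# (suc m) (suc n)) ⟩
      - (suc m · 1# + suc n · 1#)             ≈⟨ -‿+-comm _ _ ⟨
      - (suc m · 1#) - suc n · 1#             ∎

    fromℤ-*⁺ : ∀ m j → fromℤ (ℤ.+ m ℤ.* j) ≈ (m · 1#) * fromℤ j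
    fromℤ-*⁺ m (ℤ.+ n) = trans (fromℤ-cong (≡.sym (ℤ.pos-* m n))) (×1-homo-* m n)
    fromℤ-*⁺ m ℤ.-[1+ n ] = begin
      fromℤ (ℤ.+ m ℤ.* ℤ.-[1+ n ])          ≈⟨ fromℤ-cong (≡.sym (ℤ.neg-distribʳ-* (ℤ.+ m) (ℤ.+ suc n))) ⟩
      fromℤ (ℤ.- (ℤ.+ m ℤ.* ℤ.+ suc n))     ≈⟨ fromℤ-neg (ℤ.+ m ℤ.* ℤ.+ suc n) ⟩
      - fromℤ (ℤ.+ m ℤ.* ℤ.+ suc n)         ≈⟨ -‿cong (fromℤ-*⁺ m (ℤ.+ suc n)) ⟩
      - ((m · 1#) * (suc n · 1#))           ≈⟨ -‿distribʳ-* _ _ ⟩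
      (m · 1#) * - (suc n · 1#)             ∎

    fromℤ-* : ∀ i j → fromℤ (i ℤ.* j) ≈ fromℤ i * fromℤ j
    fromℤ-* (ℤ.+ m)    j = fromℤ-*⁺ m j
    fromℤ-* ℤ.-[1+ m ] j = begin
      fromℤ (ℤ.-[1+ m ] ℤ.* j)              ≈⟨ fromℤ-cong (≡.sym (ℤ.neg-distribˡ-* (ℤ.+ suc m) j)) ⟩
      fromℤ (ℤ.- (ℤ.+ suc m ℤ.* j))         ≈⟨ fromℤ-neg (ℤ.+ suc m ℤ.* j) ⟩
      - fromℤ (ℤ.+ suc m ℤ.* j)             ≈⟨ -‿cong (fromℤ-*⁺ (suc m) j) ⟩
      - ((suc m · 1#) * fromℤ j)            ≈⟨ -‿distribˡ-* _ _ ⟩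
      - (suc m · 1#) * fromℤ j              ∎

    homomorphism : ℤ.+-*-rawRing -Raw-AlmostCommutative⟶ fromCommutativeRing commutativeRing
    homomorphism = record
      { ⟦_⟧    = fromℤ
      ; +-homo = fromℤ-+
      ; *-homo = fromℤ-*
      ; -‿homo = fromℤ-neg
      ; 0-homo = refl
      ; 1-homo = +-identityʳ 1#
      }

    fromℤ-≟ : ∀ i j → Maybe (fromℤ i ≈ fromℤ j)
    fromℤ-≟ i j with i ℤ.≟ j
    ... | yes i≡j = just (fromℤ-cong i≡j)
    ... | no  _   = nothing

    open RingSolver ℤ.+-*-rawRing (fromCommutativeRing commutativeRing) homomorphism fromℤ-≟
      public using (solve; _:=_; _:+_; _:-_; :-_; con; _:*_)

  open IntegerCoefficients public using (solve; _:=_; _:+_; _:-_; :-_; con; _:*_)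

  x≤y⇒0≤y-x : ∀ {x y} → x ≤ y → 0# ≤ y - x
  x≤y⇒0≤y-x {x} x≤y = ≤-trans (≤-reflexive (sym (-‿inverseʳ x))) (+-monoˡ-≤ (- x) x≤y)

  0≤y-x⇒x≤y : ∀ {x y} → 0# ≤ y - x → x ≤ y
  0≤y-x⇒x≤y {x} {y} 0≤y-x =
    ≤-trans (≤-reflexive (sym (+-identityˡ x)))
      (≤-trans (+-monoˡ-≤ x 0≤y-x) (≤-reflexive (solve 2 (λ x y → y :- x :+ x := y) refl x y)))

  infixl 5 _⊕_

  _⊕_ : ∀ {x y u v} → x ≤ y → u ≤ v → x + u ≤ y + v
  _⊕_ {y = y} {u} x≤y u≤v = ≤-trans (+-monoˡ-≤ u x≤y)
    (≤-trans (≤-reflexive (+-comm y u)) (≤-trans (+-monoˡ-≤ y u≤v) (≤-reflexive (+-comm _ y))))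

  -- The equation says that `b - a` equals `y - x`. Linear inequalities are proved with this
  -- throughout: `⊕` adds up the required facts, and the ring solver checks that their sum is a
  -- rearrangement of the goal.
  linear : ∀ {x y a b} → x ≤ y → b + x ≈ a + y → a ≤ b
  linear {x} {y} {a} {b} x≤y b+x≈a+y =
    0≤y-x⇒x≤y (≤-trans (x≤y⇒0≤y-x x≤y) (≤-reflexive (begin
      y - x          ≈⟨ solve 3 (λ x y a → y :- x := a :+ y :- (a :+ x)) refl x y a ⟩
      a + y - (a + x)  ≈⟨ +-congʳ b+x≈a+y ⟨
      b + x - (a + x)  ≈⟨ solve 3 (λ x a b → b :+ x :- (a :+ x) := b :- a) refl x a b ⟩
      b - a          ∎)))
    where open SetoidReasoning setoid

  linear≈ : ∀ {x y a b} → x ≈ y → b + x ≈ a + y → a ≈ b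
  linear≈ x≈y eq = antisym (linear (≤-reflexive x≈y) eq)
    (linear (≤-reflexive (sym x≈y)) (sym eq))

  -‿mono-≤ : ∀ {x y} → x ≤ y → - y ≤ - x
  -‿mono-≤ {x} {y} x≤y = linear x≤y (solve 2 (λ x y → :- x :+ x := :- y :+ y) refl x y)

  +-nonNegative : ∀ {x y} → 0# ≤ x → 0# ≤ y → 0# ≤ x + y
  +-nonNegative 0≤x 0≤y = ≤-trans (≤-reflexive (sym (+-identityˡ 0#))) (0≤x ⊕ 0≤y)

  x+x≤y+y⇒x≤y : ∀ {x y} → x + x ≤ y + y → x ≤ y
  x+x≤y+y⇒x≤y {x} {y} 2x≤2y with total x y
  ... | inj₁ x≤y = x≤y
  -- Adding `y ≤ x` to the hypothesis and cancelling leaves `x ≤ y`.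
  ... | inj₂ y≤x = linear (2x≤2y ⊕ y≤x)
    (solve 2 (λ x y → y :+ (x :+ x :+ y) := x :+ (y :+ y :+ x)) refl x y)

  ≰⇒≥ : ∀ {x y} → ¬ (x ≤ y) → y ≤ x
  ≰⇒≥ {x} {y} x≰y with total x y
  ... | inj₁ x≤y = contradiction x≤y x≰y
  ... | inj₂ y≤x = y≤x

  ≰⇒> : ∀ {x y} → ¬ (y ≤ x) → x < y
  ≰⇒> y≰x = ≰⇒≥ y≰x , λ x≈y → y≰x (≤-reflexive (sym x≈y))

  0≤1 : 0# ≤ 1#
  0≤1 with total 0# 1#
  ... | inj₁ 0≤1 = 0≤1
  ... | inj₂ 1≤0 = ≤-trans (*-nonNegative 0≤-1 0≤-1)
    (≤-reflexive (solve 1 (λ x → :- x :* :- x := x :* x) refl 1# ⟨ trans ⟩ *-identityˡ 1#))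
    where
    0≤-1 : 0# ≤ - 1#
    0≤-1 = ≤-trans (≤-reflexive (sym -0#≈0#)) (-‿mono-≤ 1≤0)

  ⁻¹-nonNegative : ∀ {x} → 0# < x → 0# ≤ x ⁻¹
  ⁻¹-nonNegative {x} (0≤x , 0≉x) with total 0# (x ⁻¹)
  ... | inj₁ 0≤x⁻¹ = 0≤x⁻¹
  ... | inj₂ x⁻¹≤0 = contradiction (antisym 0≤1 1≤0) 0≉1
    where
    1≤0 : 1# ≤ 0#
    1≤0 = linear
      (*-nonNegative 0≤x (≤-trans (≤-reflexive (sym -0#≈0#)) (-‿mono-≤ x⁻¹≤0))
         ⊕ ≤-reflexive (sym (*-inverseʳ x (λ x≈0 → 0≉x (sym x≈0)))))
      (solve 3 (λ x y z → con ℤ.0ℤ :+ (con ℤ.0ℤ :+ z) := z :+ (x :* :- y :+ x :* y)) refl x (x ⁻¹) 1#)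

  0≤fromℕ : ∀ n → 0# ≤ fromℕ n
  0≤fromℕ zero    = ≤-refl
  0≤fromℕ (suc n) = +-nonNegative 0≤1 (0≤fromℕ n)

  0<fromℕ-suc : ∀ n → 0# < fromℕ (suc n)
  0<fromℕ-suc n = ≰⇒> λ ≤0 → 0≉1
    (antisym 0≤1 (linear (≤0 ⊕ 0≤fromℕ n)
      (solve 2 (λ x y → con ℤ.0ℤ :+ (x :+ y :+ con ℤ.0ℤ) := x :+ (con ℤ.0ℤ :+ y)) refl 1# (fromℕ n))))

  half : ℝ → ℝ
  half x = x / fromℕ 2

  half+half : ∀ x → half x + half x ≈ x
  half+half x = begin
    half x + half x            ≈⟨ solve 2 (λ x y → x :* y :+ x :* y := x :* ((con ℤ.1ℤ :+ (con ℤ.1ℤ :+ con ℤ.0ℤ)) :* y)) refl x (fromℕ 2 ⁻¹) ⟩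
    -- The solver reads its coefficient 1 as `1# + 0#`, which must be simplified before `fromℕ 2`
    -- appears.
    x * ((1·1 + (1·1 + 0#)) * fromℕ 2 ⁻¹)  ≈⟨ *-congˡ (*-congʳ (+-cong (+-identityʳ 1#) (+-congʳ (+-identityʳ 1#)))) ⟩
    x * (fromℕ 2 * fromℕ 2 ⁻¹)  ≈⟨ *-congˡ (*-inverseʳ _ (λ 2≈0 → proj₂ (0<fromℕ-suc 1) (sym 2≈0))) ⟩
    x * 1#                     ≈⟨ *-identityʳ x ⟩
    x                          ∎
    where
    open SetoidReasoning setoid
    1·1 = 1# + 0#

  0≤x⇒∣x∣≈x : ∀ {x} → 0# ≤ x → ∣ x ∣ ≈ x
  0≤x⇒∣x∣≈x {x} 0≤x with 0# ≤? x
  ... | yes _   = refl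
  ... | no  0≰x = contradiction 0≤x 0≰x

  x≤0⇒∣x∣≈-x : ∀ {x} → x ≤ 0# → ∣ x ∣ ≈ - x
  x≤0⇒∣x∣≈-x {x} x≤0 with 0# ≤? x
  ... | yes 0≤x = linear≈ (antisym x≤0 0≤x ⟨ +-cong ⟩ antisym x≤0 0≤x)
                    (solve 1 (λ x → :- x :+ (x :+ x) := x :+ (con ℤ.0ℤ :+ con ℤ.0ℤ)) refl x)
  ... | no  _   = refl

  ∣x∣≤ : ∀ {x y} → x ≤ y → - x ≤ y → ∣ x ∣ ≤ y
  ∣x∣≤ {x} x≤y -x≤y with 0# ≤? x
  ... | yes _ = x≤y
  ... | no  _ = -x≤y

  0≤∣x∣ : ∀ x → 0# ≤ ∣ x ∣
  0≤∣x∣ x with 0# ≤? x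
  ... | yes 0≤x = 0≤x
  ... | no  0≰x = ≤-trans (≤-reflexive (sym -0#≈0#)) (-‿mono-≤ (≰⇒≥ 0≰x))

  x≤∣x∣ : ∀ x → x ≤ ∣ x ∣
  x≤∣x∣ x with 0# ≤? x
  ... | yes _   = ≤-refl
  ... | no  0≰x = ≤-trans (≰⇒≥ 0≰x) (≤-trans (≤-reflexive (sym -0#≈0#)) (-‿mono-≤ (≰⇒≥ 0≰x)))

  -x≤∣x∣ : ∀ x → - x ≤ ∣ x ∣
  -x≤∣x∣ x with 0# ≤? x
  ... | yes 0≤x = ≤-trans (-‿mono-≤ 0≤x) (≤-trans (≤-reflexive -0#≈0#) 0≤x)
  ... | no  _   = ≤-refl

  ∣∣-cong : ∀ {x y} → x ≈ y → ∣ x ∣ ≈ ∣ y ∣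
  ∣∣-cong {x} {y} x≈y with total 0# y
  ... | inj₁ 0≤y = trans (0≤x⇒∣x∣≈x (≤-trans 0≤y (≤-reflexive (sym x≈y)))) (trans x≈y (sym (0≤x⇒∣x∣≈x 0≤y)))
  ... | inj₂ y≤0 = trans (x≤0⇒∣x∣≈-x (≤-trans (≤-reflexive x≈y) y≤0)) (trans (-‿cong x≈y) (sym (x≤0⇒∣x∣≈-x y≤0)))

  ∣-x∣≈∣x∣ : ∀ x → ∣ - x ∣ ≈ ∣ x ∣
  ∣-x∣≈∣x∣ x = antisym
    (∣x∣≤ (-x≤∣x∣ x) (≤-trans (≤-reflexive (-‿involutive x)) (x≤∣x∣ x)))
    (∣x∣≤ (≤-trans (≤-reflexive (sym (-‿involutive x))) (-x≤∣x∣ (- x))) (x≤∣x∣ (- x)))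

  ∣x-y∣≈∣y-x∣ : ∀ x y → ∣ x - y ∣ ≈ ∣ y - x ∣
  ∣x-y∣≈∣y-x∣ x y = trans (∣∣-cong (solve 2 (λ x y → x :- y := :- (y :- x)) refl x y)) (∣-x∣≈∣x∣ (y - x))

  ∣∣-triangle : ∀ x y → ∣ x ∣ ≤ ∣ y ∣ + ∣ x - y ∣
  ∣∣-triangle x y = ∣x∣≤
    (≤-trans (≤-reflexive (solve 2 (λ x y → x := y :+ (x :- y)) refl x y)) (x≤∣x∣ y ⊕ x≤∣x∣ (x - y)))
    (≤-trans (≤-reflexive (solve 2 (λ x y → :- x := :- y :+ (:- (x :- y))) refl x y)) (-x≤∣x∣ y ⊕ -x≤∣x∣ (x - y)))

  ≤⊓+ : ∀ {x y z u} → x ≤ y + u → x ≤ z + u → x ≤ y ⊓ z + u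
  ≤⊓+ {y = y} {z} x≤y+u x≤z+u with ⊓-sel y z
  ... | inj₁ eq = ≤-trans x≤y+u (≤-reflexive (+-congʳ (sym eq)))
  ... | inj₂ eq = ≤-trans x≤z+u (≤-reflexive (+-congʳ (sym eq)))

  open Extrema totalOrder public

  minimiser : ∀ {m} (f : Fin (suc m) → ℝ) → ∃[ i ] (∀ j → f i ≤ f j)
  minimiser {m} f = argmin f zero (allFin (suc m))
                  , λ j → All.lookup (f[argmin]≤f[xs] {f = f} zero (allFin (suc m))) (∈-allFin j)

  maximiser : ∀ {A : Set} (f : A → ℝ) x xs → ∃[ m ] (∀ {y} → y ∈ xs → f y ≤ f m)
  maximiser f x xs = argmax f x xs , All.lookup (f[xs]≤f[argmax] {f = f} x xs)

  -- A discrete intermediate value theorem. It finds both the edge below a given position and the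
  -- gap that contains it.
  bracket : ∀ (f : ℕ → ℝ) m {z} → f 0 ≤ z → z ≤ f (suc m) →
            ∃[ i ] f (toℕ {suc m} i) ≤ z × z ≤ f (suc (toℕ i))
  bracket f zero    f0≤z z≤ = zero , f0≤z , z≤
  bracket f (suc m) {z} f0≤z z≤ with total z (f 1)
  ... | inj₁ z≤f1 = zero , f0≤z , z≤f1
  ... | inj₂ f1≤z = let i , ≤z , z≤ = bracket (f ∘ suc) m f1≤z z≤ in suc i , ≤z , z≤

  /-≤ : ∀ {x y n} → 0# < n → x ≤ n * y → x / n ≤ y
  /-≤ {x} {y} {n} 0<n@(_ , 0≉n) x≤ny = linear
    (*-nonNegative (x≤y⇒0≤y-x x≤ny) (⁻¹-nonNegative 0<n)
      ⊕ ≤-reflexive (trans (*-congˡ (*-inverseʳ n (λ n≈0 → 0≉n (sym n≈0)))) (*-identityʳ y)))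
    (solve 4 (λ x y n i → y :+ (con ℤ.0ℤ :+ y :* (n :* i)) := x :* i :+ ((n :* y :- x) :* i :+ y)) refl x y n (n ⁻¹))

-- Paths and potentials in a metric graph

module MetricGraphProperties (R : Reals) where
  open RealProperties R
  open MetricGraphs R public

  module Paths (G : MetricGraph) where
    open MetricGraph G

    ≡⇒SamePoint : ∀ {e f s t 0≤s s≤w 0≤t t≤w} → e ≡ f → s ≈ t →
                  SamePoint G (on e s 0≤s s≤w) (on f t 0≤t t≤w)
    ≡⇒SamePoint ≡.refl s≈t = Eq.return (sameParameter s≈t)

    same-refl : ∀ {x} → SamePoint G x x
    same-refl = Eq.reflexive (Identified G)

    same-sym : ∀ {x y} → SamePoint G x y → SamePoint G y x
    same-sym = Eq.symmetric (Identified G)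

    same-trans : ∀ {x y z} → SamePoint G x y → SamePoint G y z → SamePoint G x z
    same-trans = Eq.transitive (Identified G)

    -- Only the lengths of paths matter, and only up to `≈`, so later constructions combine
    -- statements of this form instead of paths.
    Reach : (x y : Point graph) → ℝ → Set
    Reach x y d = Σ[ γ ∈ Path G x y ] length γ ≈ d

    reach-cong : ∀ {x y d e} → d ≈ e → Reach x y d → Reach x y e
    reach-cong d≈e (γ , eq) = γ , trans eq d≈e

    reach-same : ∀ {x y} → SamePoint G x y → Reach x y 0#
    reach-same x~y = stay x~y , refl

    reach-trans : ∀ {x y z d e} → Reach x y d → Reach y z e → Reach x z (d + e)
    reach-trans {z = z} {d} {e} (γ , γ≈d) (δ , δ≈e) =
      let η , η≈ = append γ δ in η , trans η≈ (+-cong γ≈d δ≈e)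
      where
      append : ∀ {x y} (γ : Path G x y) (δ : Path G y z) → Reach x z (length γ + length δ)
      append (stay x~y) (stay y~z)          = stay (same-trans x~y y~z) , sym (+-identityˡ 0#)
      append (stay x~y) (move e s t y~s δ)  = move e s t (same-trans x~y y~s) δ , sym (+-identityˡ _)
      append (move e s t x~s γ) δ =
        let η , η≈ = append γ δ in move e s t x~s η , trans (+-congˡ η≈) (sym (+-assoc _ _ _))

    reach-segment : ∀ {e s t 0≤s s≤w 0≤t t≤w} →
                    Reach (on e s 0≤s s≤w) (on e t 0≤t t≤w) ∣ t - s ∣
    reach-segment {e} {s} {t} = move e s t same-refl (stay same-refl) , +-identityʳ _

    reach-sym : ∀ {x y d} → Reach x y d → Reach y x d
    reach-sym {d = d} (γ , γ≈d) = reach-cong γ≈d (reverse γ)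
      where
      reverse : ∀ {x y} (γ : Path G x y) → Reach y x (length γ)
      reverse (stay x~y)          = reach-same (same-sym x~y)
      reverse (move e s t x~s γ)  = reach-cong
        (trans (+-congˡ (trans (+-identityʳ _) (∣x-y∣≈∣y-x∣ s t))) (+-comm _ _))
        (reach-trans (reverse γ) (reach-trans reach-segment (reach-same (same-sym x~s))))

    0≤length : ∀ {x y} (γ : Path G x y) → 0# ≤ length γ
    0≤length (stay _)         = ≤-refl
    0≤length (move _ s t _ γ) = +-nonNegative (0≤∣x∣ (t - s)) (0≤length γ)

    reach⇒0≤ : ∀ {x y d} → Reach x y d → 0# ≤ d
    reach⇒0≤ (γ , γ≈d) = ≤-trans (0≤length γ) (≤-reflexive γ≈d)

    record Potential (F : Point graph → ℝ) : Set where
      field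
        respects  : ∀ {x y} → Identified G x y → F x ≈ F y
        lipschitz : ∀ e s t {0≤s s≤w 0≤t t≤w} →
                    F (on e s 0≤s s≤w) ≤ F (on e t 0≤t t≤w) + ∣ t - s ∣

      -- `≈` is already an equivalence, so it suffices to check the generators of `SamePoint`.
      respects-same : ∀ {x y} → SamePoint G x y → F x ≈ F y
      respects-same = Eq.gfold isEquivalence F respects

      potential≤length : ∀ {x y} (γ : Path G x y) → F x ≤ F y + length γ
      potential≤length (stay x~y) = ≤-reflexive (trans (respects-same x~y) (sym (+-identityʳ _)))
      potential≤length {x} {y} (move e s t {0≤t = 0≤t} {t≤w} x~s γ) =
        linear (≤-reflexive (respects-same x~s) ⊕ lipschitz e s t ⊕ potential≤length γ)
          (solve 6 (λ x y s t l u → y :+ (u :+ l) :+ (x :+ s :+ t) := x :+ (s :+ (t :+ u) :+ (y :+ l))) refl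
             (F x) (F y) _ _ (length γ) ∣ t - s ∣)

  isDiameter-cong : ∀ {G C D} → C ≈ D → IsDiameter G C → IsDiameter G D
  isDiameter-cong C≈D ((x , y , (γ , γ≈C) , C≤) , ≤C) =
      (x , y , (γ , trans γ≈C C≈D) , λ δ → ≤-trans (≤-reflexive (sym C≈D)) (C≤ δ))
    , λ x y → let d , isDist , d≤C = ≤C x y in d , isDist , ≤-trans d≤C (≤-reflexive C≈D)

-- The unrolled cycle and its metric

module CycleProperties (R : Reals) (L : Reals.ℝ R) (G : MetricGraphs.Cycle R L) where
  open RealProperties R
  open MetricGraphProperties R
  open Cycle G using (k; edgeLength; positive; totalLength; metricGraph)
  open MetricGraph metricGraph using (graph)

  n : ℕ
  n = suc k

  edge : ℕ → Fin n
  edge j = j mod n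

  toℕ-edge : ∀ j → toℕ (edge j) ≡ j % n
  toℕ-edge j = toℕ-fromℕ< (m%n<n j n)

  edge-toℕ : ∀ e → edge (toℕ e) ≡ e
  edge-toℕ = mod-toℕ

  -- The left side is the target of `edge j` as the cycle defines it; the right side is the next
  -- vertex of the unrolled line.
  edge-suc : ∀ j → edge (suc (toℕ (edge j))) ≡ edge (suc j)
  edge-suc j = toℕ-injective (begin
    toℕ (edge (suc (toℕ (edge j))))  ≡⟨ toℕ-edge (suc (toℕ (edge j))) ⟩
    suc (toℕ (edge j)) % n           ≡⟨ ≡.cong (λ i → suc i % n) (toℕ-edge j) ⟩
    suc (j % n) % n                  ≡⟨ %-distribˡ-+ 1 (j % n) n ⟩
    (1 % n ℕ.+ j % n % n) % n        ≡⟨ ≡.cong (λ i → (1 % n ℕ.+ i) % n) (m%n%n≡m%n j n) ⟩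
    (1 % n ℕ.+ j % n) % n            ≡⟨ %-distribˡ-+ 1 j n ⟨
    suc j % n                        ≡⟨ toℕ-edge (suc j) ⟨
    toℕ (edge (suc j))               ∎)
    where open ≡.≡-Reasoning

  edge-+n : ∀ j → edge (j ℕ.+ n) ≡ edge j
  edge-+n j = toℕ-injective (≡.trans (toℕ-edge (j ℕ.+ n))
    (≡.trans ([m+n]%n≡m%n j n) (≡.sym (toℕ-edge j))))

  partialSum : (ℕ → ℝ) → ℕ → ℝ
  partialSum f zero    = 0#
  partialSum f (suc j) = partialSum f j + f j

  partialSum-suc : ∀ f j → partialSum f (suc j) ≈ f 0 + partialSum (f ∘ suc) j
  partialSum-suc f zero    = +-comm _ _
  partialSum-suc f (suc j) = trans (+-congʳ (partialSum-suc f j)) (+-assoc _ _ _)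

  sum≈partialSum : ∀ {m} (f : Fin m → ℝ) g → (∀ i → f i ≈ g (toℕ i)) → sum f ≈ partialSum g m
  sum≈partialSum {zero}  f g f≈g = refl
  sum≈partialSum {suc m} f g f≈g = begin
    f zero + sum (f ∘ suc)               ≈⟨ +-cong (f≈g zero) (sum≈partialSum (f ∘ suc) (g ∘ suc) (f≈g ∘ suc)) ⟩
    g 0 + partialSum (g ∘ suc) m         ≈⟨ partialSum-suc g m ⟨
    partialSum g (suc m)                 ∎
    where open SetoidReasoning setoid

  -- mark j is the position of the vertex j of the universal cover, an
  -- infinite line on which positions differing by L lie over the same point.
  mark : ℕ → ℝ
  mark = partialSum (edgeLength ∘ edge)

  mark-n : mark n ≈ L
  mark-n = trans
    (sym (sum≈partialSum edgeLength (edgeLength ∘ edge) λ i → reflexive (≡.cong edgeLength (≡.sym (edge-toℕ i)))))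
    totalLength

  mark-+n : ∀ j → mark (j ℕ.+ n) ≈ mark j + L
  mark-+n zero    = trans mark-n (sym (+-identityˡ L))
  mark-+n (suc j) = begin
    mark (j ℕ.+ n) + edgeLength (edge (j ℕ.+ n))
      ≈⟨ +-cong (mark-+n j) (reflexive (≡.cong edgeLength (edge-+n j))) ⟩
    mark j + L + edgeLength (edge j)
      ≈⟨ solve 3 (λ x y z → x :+ y :+ z := x :+ z :+ y) refl (mark j) L (edgeLength (edge j)) ⟩
    mark j + edgeLength (edge j) + L  ∎
    where open SetoidReasoning setoid

  mark-toℕ : ∀ e → mark (suc (toℕ e)) ≈ mark (toℕ e) + edgeLength e
  mark-toℕ e = +-congˡ (reflexive (≡.cong edgeLength (edge-toℕ e)))

  0≤edgeLength : ∀ e → 0# ≤ edgeLength e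
  0≤edgeLength e = proj₁ (positive e)

  mark-mono : ∀ i j → mark j ≤ mark (i ℕ.+ j)
  mark-mono zero    j = ≤-refl
  mark-mono (suc i) j = linear (mark-mono i j ⊕ 0≤edgeLength (edge (i ℕ.+ j)))
    (solve 3 (λ x y z → x :+ y :+ (z :+ con ℤ.0ℤ) := z :+ (x :+ y)) refl
      (mark (i ℕ.+ j)) (edgeLength (edge (i ℕ.+ j))) (mark j))

  mark≤L : ∀ {j} → j ℕ.≤ n → mark j ≤ L
  mark≤L {j} j≤n = ≤-trans (mark-mono (n ℕ.∸ j) j)
    (≤-reflexive (trans (reflexive (≡.cong mark (ℕ.m∸n+n≡m j≤n))) mark-n))

  0≤mark : ∀ j → 0# ≤ mark j
  0≤mark j = ≤-trans (mark-mono j 0) (≤-reflexive (reflexive (≡.cong mark (ℕ.+-identityʳ j))))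

  edgeOf : Point graph → Fin n
  edgeOf (vertex i)   = i
  edgeOf (on e _ _ _) = e

  offset : Point graph → ℝ
  offset (vertex i)   = 0#
  offset (on _ t _ _) = t

  0≤offset : ∀ x → 0# ≤ offset x
  0≤offset (vertex i)     = ≤-refl
  0≤offset (on _ _ 0≤t _) = 0≤t

  offset≤ : ∀ x → offset x ≤ edgeLength (edgeOf x)
  offset≤ (vertex i)     = 0≤edgeLength i
  offset≤ (on _ _ _ t≤w) = t≤w

  -- This does not respect `SamePoint`: the vertex 0 has position 0, but as the end of the last edge
  -- it has position `L`. Only expressions that identify the two, such as `circ`, are well defined
  -- on the cycle.
  position : Point graph → ℝ
  position x = mark (toℕ (edgeOf x)) + offset x

  0≤position : ∀ x → 0# ≤ position x
  0≤position x = +-nonNegative (0≤mark (toℕ (edgeOf x))) (0≤offset x)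

  position≤L : ∀ x → position x ≤ L
  position≤L x = ≤-trans (≤-refl ⊕ offset≤ x)
    (≤-trans (≤-reflexive (sym (mark-toℕ (edgeOf x)))) (mark≤L (toℕ<n (edgeOf x))))

  0≤L : 0# ≤ L
  0≤L = ≤-trans (0≤mark n) (≤-reflexive mark-n)

  pointAt : ∀ {z} → 0# ≤ z → z ≤ L → ∃[ x ] position x ≈ z
  pointAt {z} 0≤z z≤L = let e , mark≤z , z≤mark = bracket mark k 0≤z (≤-trans z≤L (≤-reflexive (sym mark-n))) in
    on e (z - mark (toℕ e))
      (x≤y⇒0≤y-x mark≤z)
      (linear (z≤mark ⊕ ≤-reflexive (mark-toℕ e))
         (solve 4 (λ l z s s′ → l :+ (z :+ s′) := (z :- s) :+ (s′ :+ (s :+ l))) refl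
           (edgeLength e) z (mark (toℕ e)) (mark (suc (toℕ e)))))
    , solve 2 (λ z s → s :+ (z :- s) := z) refl z (mark (toℕ e))

  opaque
    -- The two ways round between points whose positions differ by `u`; meant for `∣ u ∣ ≤ L`.
    arc : ℝ → ℝ
    arc u = ∣ u ∣ ⊓ (L - ∣ u ∣)

    arc-cong : ∀ {u v} → u ≈ v → arc u ≈ arc v
    arc-cong u≈v = ⊓-cong (∣∣-cong u≈v) (+-congˡ (-‿cong (∣∣-cong u≈v)))

    arc-lipschitz : ∀ u v → arc u ≤ arc v + ∣ u - v ∣
    arc-lipschitz u v = ≤⊓+
      (≤-trans (x⊓y≤x _ _) (∣∣-triangle u v))
      (≤-trans (x⊓y≤y _ _) (linear (∣∣-triangle v u ⊕ ≤-reflexive (∣x-y∣≈∣y-x∣ v u))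
        (solve 5 (λ l u v d e → l :- v :+ d :+ (v :+ e) := l :- u :+ (u :+ e :+ d)) refl L ∣ u ∣ ∣ v ∣ _ _)))

    arc-sym : ∀ x y → arc (x - y) ≈ arc (y - x)
    arc-sym x y = ⊓-cong (∣x-y∣≈∣y-x∣ x y) (+-congˡ (-‿cong (∣x-y∣≈∣y-x∣ x y)))

    arc≤∣∣ : ∀ u → arc u ≤ ∣ u ∣
    arc≤∣∣ u = x⊓y≤x _ _

    arc≤L-∣∣ : ∀ u → arc u ≤ L - ∣ u ∣
    arc≤L-∣∣ u = x⊓y≤y _ _

    arc-glb : ∀ {d u} → d ≤ ∣ u ∣ → d ≤ L - ∣ u ∣ → d ≤ arc u
    arc-glb = ⊓-glb

    arc-sel : ∀ u → arc u ≈ ∣ u ∣ ⊎ arc u ≈ L - ∣ u ∣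
    arc-sel u = ⊓-sel ∣ u ∣ (L - ∣ u ∣)

    -- The positions 0 and L lie over the same point.
    arc-0-L : ∀ {x y p} → x ≈ 0# → y ≈ L → 0# ≤ p → p ≤ L → arc (x - p) ≈ arc (y - p)
    arc-0-L {x} {y} {p} x≈0 y≈L 0≤p p≤L = trans (⊓-comm _ _) (⊓-cong eq₂ eq₁)
      where
      x≤p : x ≤ p
      x≤p = ≤-trans (≤-reflexive x≈0) 0≤p
      p≤y : p ≤ y
      p≤y = ≤-trans p≤L (≤-reflexive (sym y≈L))
      eq₁ : ∣ x - p ∣ ≈ L - ∣ y - p ∣
      eq₁ = linear≈ (x≤0⇒∣x∣≈-x (linear x≤p (solve 2 (λ x p → con ℤ.0ℤ :+ x := x :- p :+ p) refl x p))
          ⟨ +-cong ⟩ 0≤x⇒∣x∣≈x (x≤y⇒0≤y-x p≤y) ⟨ +-cong ⟩ sym x≈0 ⟨ +-cong ⟩ y≈L)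
        (solve 6 (λ x y p l u v → l :- v :+ (u :+ v :+ con ℤ.0ℤ :+ y) := u :+ (:- (x :- p) :+ (y :- p) :+ x :+ l)) refl
          x y p L ∣ x - p ∣ ∣ y - p ∣)
      eq₂ : L - ∣ x - p ∣ ≈ ∣ y - p ∣
      eq₂ = linear≈ (sym eq₁) (solve 3 (λ l u v → v :+ (l :- v) := l :- u :+ u) refl L ∣ x - p ∣ ∣ y - p ∣)

  circ : Point graph → Point graph → ℝ
  circ x y = arc (position x - position y)

  circ-sym : ∀ x y → circ x y ≈ circ y x
  circ-sym x y = arc-sym (position x) (position y)

  circ-0-L : ∀ {x y} z → position x ≈ 0# → position y ≈ L → circ x z ≈ circ y z
  circ-0-L z x≈0 y≈L = arc-0-L x≈0 y≈L (0≤position z) (position≤L z)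

  ∣position-position∣≤L : ∀ x y → ∣ position x - position y ∣ ≤ L
  ∣position-position∣≤L x y = ∣x∣≤
    (linear (position≤L x ⊕ 0≤position y)
      (solve 3 (λ x y l → l :+ (x :+ con ℤ.0ℤ) := x :- y :+ (l :+ y)) refl (position x) (position y) L))
    (linear (position≤L y ⊕ 0≤position x)
      (solve 3 (λ x y l → l :+ (y :+ con ℤ.0ℤ) := :- (x :- y) :+ (l :+ x)) refl (position x) (position y) L))

  0≤circ : ∀ x y → 0# ≤ circ x y
  0≤circ x y = arc-glb (0≤∣x∣ _) (x≤y⇒0≤y-x (∣position-position∣≤L x y))

  -- u + c ≈ 0 modulo L, for u and c of size at most L.
  data Opposite (u c : ℝ) : Set where
    same    : u ≈ - c     → Opposite u c
    ahead   : u ≈ L - c   → Opposite u c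
    behind  : u ≈ - c - L → Opposite u c

  -- One of the two terms of `arc` is always small enough: the first for `same`, the second
  -- otherwise. For `behind`, `∣ u ∣` is at least `c + L`, so that the second is at most `- c`.
  arc≤ : ∀ {u c} → Opposite u c → 0# ≤ c → arc u ≤ c
  arc≤ {u} {c} (same u≈-c) 0≤c = ≤-trans (arc≤∣∣ u) (∣x∣≤
    (linear (≤-reflexive u≈-c ⊕ 0≤c ⊕ 0≤c)
      (solve 2 (λ u c → c :+ (u :+ con ℤ.0ℤ :+ con ℤ.0ℤ) := u :+ (:- c :+ c :+ c)) refl u c))
    (linear (≤-reflexive (sym u≈-c)) (solve 2 (λ u c → c :+ :- c := :- u :+ u) refl u c)))
  arc≤ {u} {c} (ahead u≈L-c) 0≤c = ≤-trans (arc≤L-∣∣ u)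
    (linear (x≤∣x∣ u ⊕ ≤-reflexive (sym u≈L-c))
      (solve 4 (λ u v c l → c :+ (u :+ (l :- c)) := l :- v :+ (v :+ u)) refl u ∣ u ∣ c L))
  arc≤ {u} {c} (behind u≈-c-L) 0≤c = ≤-trans (arc≤L-∣∣ u)
    (linear (-x≤∣x∣ u ⊕ ≤-reflexive u≈-c-L ⊕ 0≤c ⊕ 0≤c)
      (solve 4 (λ u v c l → c :+ (:- u :+ u :+ con ℤ.0ℤ :+ con ℤ.0ℤ) := l :- v :+ (v :+ (:- c :- l) :+ c :+ c)) refl u ∣ u ∣ c L))

  ≤arc : ∀ {d u c} → Opposite u c → ∣ u ∣ ≤ L → d ≤ c → d ≤ L - c → d ≤ arc u
  ≤arc {d} {u} {c} opp ∣u∣≤L d≤c d≤L-c = arc-glb (d≤∣u∣ opp)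
    (linear (∣x∣≤ (u≤L-d opp) (-u≤L-d opp)) (solve 3 (λ d v l → l :- v :+ v := d :+ (l :- d)) refl d ∣ u ∣ L))
    where
    d≤∣u∣ : Opposite u c → d ≤ ∣ u ∣
    d≤∣u∣ (same u≈-c) = linear (d≤c ⊕ -x≤∣x∣ u ⊕ ≤-reflexive u≈-c)
      (solve 4 (λ d u v c → v :+ (d :+ :- u :+ u) := d :+ (c :+ v :+ :- c)) refl d u ∣ u ∣ c)
    d≤∣u∣ (ahead u≈L-c) = ≤-trans d≤L-c (≤-trans (≤-reflexive (sym u≈L-c)) (x≤∣x∣ u))
    d≤∣u∣ (behind u≈-c-L) = linear (-x≤∣x∣ u ⊕ ≤-reflexive u≈-c-L ⊕ d≤c ⊕ 0≤L)
      (solve 5 (λ d u v c l → v :+ (:- u :+ u :+ d :+ con ℤ.0ℤ) := d :+ (v :+ (:- c :- l) :+ c :+ l)) refl d u ∣ u ∣ c L)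

    u≤L-d : Opposite u c → u ≤ L - d
    u≤L-d (same u≈-c) = linear (≤-reflexive u≈-c ⊕ d≤c ⊕ 0≤L)
      (solve 4 (λ d u c l → l :- d :+ (u :+ d :+ con ℤ.0ℤ) := u :+ (:- c :+ c :+ l)) refl d u c L)
    u≤L-d (ahead u≈L-c) = linear (≤-reflexive u≈L-c ⊕ d≤c)
      (solve 4 (λ d u c l → l :- d :+ (u :+ d) := u :+ (l :- c :+ c)) refl d u c L)
    u≤L-d (behind u≈-c-L) = linear (≤-reflexive u≈-c-L ⊕ d≤c ⊕ 0≤L ⊕ 0≤L)
      (solve 4 (λ d u c l → l :- d :+ (u :+ d :+ con ℤ.0ℤ :+ con ℤ.0ℤ) := u :+ (:- c :- l :+ c :+ l :+ l)) refl d u c L)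

    -u≤L-d : Opposite u c → - u ≤ L - d
    -u≤L-d (same u≈-c) = linear (≤-reflexive (sym u≈-c) ⊕ d≤L-c)
      (solve 4 (λ d u c l → l :- d :+ (:- c :+ d) := :- u :+ (u :+ (l :- c))) refl d u c L)
    -u≤L-d (ahead u≈L-c) = linear (≤-reflexive (sym u≈L-c) ⊕ d≤L-c ⊕ 0≤L)
      (solve 4 (λ d u c l → l :- d :+ (l :- c :+ d :+ con ℤ.0ℤ) := :- u :+ (u :+ (l :- c) :+ l)) refl d u c L)
    -- Here `- u` is `c + L`, so `∣ u ∣ ≤ L` forces `c ≤ 0`. It is used twice because the goal is
    -- `c + d ≤ 0`, with `d ≤ c`.
    -u≤L-d (behind u≈-c-L) =
      linear (≤-reflexive u≈-c-L ⊕ d≤c ⊕ ∣u∣≤L ⊕ ∣u∣≤L ⊕ -x≤∣x∣ u ⊕ -x≤∣x∣ u)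
        (solve 5 (λ d u v c l → l :- d :+ (u :+ d :+ v :+ v :+ :- u :+ :- u) := :- u :+ (:- c :- l :+ c :+ l :+ l :+ v :+ v)) refl d u ∣ u ∣ c L)

  -- z is one of the two positions over x that can occur in [0, 2 L].
  Lift : Point graph → ℝ → Set
  Lift x z = z ≈ position x ⊎ z ≈ position x + L

  -- This lets `circ` be estimated from any lifted positions, so that intervals across the seam need
  -- no treatment of their own.
  lifts⇒opposite : ∀ {x y u v} → Lift x u → Lift y v → Opposite (position x - position y) (v - u)
  lifts⇒opposite {x} {y} {u} {v} (inj₁ u≈) (inj₁ v≈) = same (linear≈ (sym u≈ ⟨ +-cong ⟩ v≈)
    (solve 4 (λ x y u v → :- (v :- u) :+ (x :+ v) := x :- y :+ (u :+ y)) refl (position x) (position y) u v))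
  lifts⇒opposite {x} {y} {u} {v} (inj₁ u≈) (inj₂ v≈) = ahead (linear≈ (sym u≈ ⟨ +-cong ⟩ v≈)
    (solve 5 (λ x y u v l → l :- (v :- u) :+ (x :+ v) := x :- y :+ (u :+ (y :+ l))) refl (position x) (position y) u v L))
  lifts⇒opposite {x} {y} {u} {v} (inj₂ u≈) (inj₁ v≈) = behind (linear≈ (sym u≈ ⟨ +-cong ⟩ v≈)
    (solve 5 (λ x y u v l → :- (v :- u) :- l :+ (x :+ l :+ v) := x :- y :+ (u :+ y)) refl (position x) (position y) u v L))
  lifts⇒opposite {x} {y} {u} {v} (inj₂ u≈) (inj₂ v≈) = same (linear≈ (sym u≈ ⟨ +-cong ⟩ v≈)
    (solve 5 (λ x y u v l → :- (v :- u) :+ (x :+ l :+ v) := x :- y :+ (u :+ (y :+ l))) refl (position x) (position y) u v L))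

  circ≤lift : ∀ {x y u v} → Lift x u → Lift y v → u ≤ v → circ x y ≤ v - u
  circ≤lift {x} {y} xu yv u≤v = arc≤ (lifts⇒opposite {x} {y} xu yv) (x≤y⇒0≤y-x u≤v)

  ≤circ : ∀ {x y u v d} → Lift x u → Lift y v → d ≤ v - u → d ≤ L - (v - u) → d ≤ circ x y
  ≤circ {x} {y} xu yv = ≤arc (lifts⇒opposite {x} {y} xu yv) (∣position-position∣≤L x y)

  glue : List (Point graph × Point graph) → MetricGraph
  glue gs = record { graph = graph ; glued = gs }

  -- Gluings are handed back to the caller, so that the same case analysis serves the cycle itself,
  -- with `gs` empty, and the fused cycle.
  circ-respects : ∀ {gs x y} → Identified (glue gs) x y → (x , y) ∈ gs ⊎ (∀ z → circ x z ≈ circ y z)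
  circ-respects (sameParameter s≈t) = inj₂ (λ z → arc-cong (+-congʳ (+-congˡ s≈t)))
  circ-respects (atSource t≈0)      = inj₂ (λ z → arc-cong (+-congʳ (+-congˡ t≈0)))
  circ-respects (gluing xy∈gs)      = inj₁ xy∈gs
  circ-respects (atTarget {e} {t} {0≤t} {t≤w} t≈w) with ℕ.m≤n⇒m<n∨m≡n (toℕ<n e)
  ... | inj₁ e+1<n = inj₂ (λ z → arc-cong (+-congʳ (begin
          mark (toℕ e) + t             ≈⟨ +-congˡ t≈w ⟩
          mark (toℕ e) + edgeLength e  ≈⟨ mark-toℕ e ⟨
          mark (suc (toℕ e))           ≡⟨ ≡.cong mark (≡.trans (toℕ-edge (suc (toℕ e))) (m<n⇒m%n≡m e+1<n)) ⟨
          mark (toℕ (edge (suc (toℕ e)))) ≈⟨ +-identityʳ _ ⟨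
          mark (toℕ (edge (suc (toℕ e)))) + 0# ∎)))
    where open SetoidReasoning setoid
  -- The last edge ends in the vertex 0, where the position drops from `L` to 0.
  ... | inj₂ e+1≡n = inj₂ (λ z → sym (circ-0-L {vertex (edge (suc (toℕ e)))} {on e t 0≤t t≤w} z
          (trans (+-identityʳ _) (reflexive (≡.cong mark
            (≡.trans (toℕ-edge (suc (toℕ e))) (≡.trans (≡.cong (_% n) e+1≡n) (n%n≡0 n))))))
          (begin
             mark (toℕ e) + t             ≈⟨ +-congˡ t≈w ⟩
             mark (toℕ e) + edgeLength e  ≈⟨ mark-toℕ e ⟨
             mark (suc (toℕ e))           ≡⟨ ≡.cong mark e+1≡n ⟩
             mark n                       ≈⟨ mark-n ⟩
             L                            ∎)))
    where open SetoidReasoning setoid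

  circ-lipschitz : ∀ z e s t {0≤s s≤w 0≤t t≤w} →
                   circ (on e s 0≤s s≤w) z ≤ circ (on e t 0≤t t≤w) z + ∣ t - s ∣
  circ-lipschitz z e s t = ≤-trans (arc-lipschitz _ _) (≤-reflexive (+-congˡ (trans
    (∣∣-cong (solve 4 (λ m s t p → m :+ s :- p :- (m :+ t :- p) := s :- t) refl (mark (toℕ e)) s t (position z)))
    (∣x-y∣≈∣y-x∣ s t))))

  circ-self : ∀ x → circ x x ≤ 0#
  circ-self x = ≤-trans (arc≤∣∣ _)
    (≤-reflexive (trans (∣∣-cong (-‿inverseʳ (position x))) (0≤x⇒∣x∣≈x ≤-refl)))

  -- Paths along the two arcs of the cycle

  module Glued (gs : List (Point graph × Point graph)) where
    open Paths (glue gs) public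

    reach-toNext : ∀ j {s 0≤s s≤w} →
                   Reach (on (edge j) s 0≤s s≤w) (vertex (edge (suc j))) (edgeLength (edge j) - s)
    reach-toNext j {s} {s≤w = s≤w} = reach-cong
      (trans (+-identityʳ _) (0≤x⇒∣x∣≈x (x≤y⇒0≤y-x s≤w)))
      (reach-trans reach-segment (reach-same
        (≡.subst (λ v → SamePoint (glue gs) (on (edge j) w (0≤edgeLength (edge j)) ≤-refl) (vertex v)) (edge-suc j)
          (Eq.return (atTarget refl)))))
      where w = edgeLength (edge j)

    reach-fromPrevious : ∀ j {s 0≤s s≤w} → Reach (vertex (edge j)) (on (edge j) s 0≤s s≤w) s
    reach-fromPrevious j {s} {0≤s} = reach-cong
      (trans (+-identityˡ _) (trans (0≤x⇒∣x∣≈x (x≤y⇒0≤y-x 0≤s)) (solve 1 (λ s → s :- con ℤ.0ℤ := s) refl s)))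
      (reach-trans
        (reach-same (same-sym (Eq.return (atSource {0≤t = ≤-refl} {0≤edgeLength (edge j)} refl))))
        reach-segment)

    reach-vertices : ∀ i j → Reach (vertex (edge j)) (vertex (edge (i ℕ.+ j))) (mark (i ℕ.+ j) - mark j)
    reach-vertices zero    j = reach-cong (sym (-‿inverseʳ _)) (reach-same same-refl)
    reach-vertices (suc i) j = reach-cong
      (solve 3 (λ a b c → a :- b :+ (con ℤ.0ℤ :+ (c :- con ℤ.0ℤ)) := a :+ c :- b) refl
        (mark (i ℕ.+ j)) (mark j) (edgeLength (edge (i ℕ.+ j))))
      (reach-trans (reach-vertices i j)
        (reach-trans (reach-fromPrevious (i ℕ.+ j) {0≤s = ≤-refl} {0≤edgeLength (edge (i ℕ.+ j))})
          (reach-toNext (i ℕ.+ j))))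

    -- The indices count edges of the unrolled line and may exceed `k`, so this also covers travel
    -- past the vertex 0.
    reach-line : ∀ {i j} → i ℕ.< j → ∀ {s t 0≤s s≤w 0≤t t≤w} →
                 Reach (on (edge i) s 0≤s s≤w) (on (edge j) t 0≤t t≤w) ((mark j + t) - (mark i + s))
    reach-line {i} {j} i<j {s} {t} = reach-cong
      (solve 5 (λ w s t m m′ → (w :- s) :+ (m′ :- (m :+ w)) :+ t := (m′ :+ t) :- (m :+ s)) refl
        (edgeLength (edge i)) s t (mark i) (mark j))
      (reach-trans (reach-trans (reach-toNext i)
         (≡.subst (λ l → Reach (vertex (edge (suc i))) (vertex (edge l)) (mark l - mark (suc i)))
           (ℕ.m∸n+n≡m i<j) (reach-vertices (j ℕ.∸ suc i) (suc i))))
        (reach-fromPrevious j))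

    offset≤′ : ∀ x → offset x ≤ edgeLength (edge (toℕ (edgeOf x)))
    offset≤′ x = ≤-trans (offset≤ x) (≤-reflexive (reflexive (≡.cong edgeLength (≡.sym (edge-toℕ (edgeOf x))))))

    -- A normal form to which `reach-line` applies, for vertices as well.
    onEdge : Point graph → Point graph
    onEdge x = on (edge (toℕ (edgeOf x))) (offset x) (0≤offset x) (offset≤′ x)

    same-onEdge : ∀ x → SamePoint (glue gs) x (onEdge x)
    same-onEdge (on e t 0≤t t≤w) = ≡⇒SamePoint (≡.sym (edge-toℕ e)) refl
    same-onEdge (vertex i)       = same-trans
      (same-sym (Eq.return (atSource {0≤t = ≤-refl} {0≤edgeLength i} refl)))
      (≡⇒SamePoint (≡.sym (edge-toℕ i)) refl)

    reach-onEdge : ∀ {x y d} → Reach (onEdge x) (onEdge y) d → Reach x y d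
    reach-onEdge {x} {y} {d} r = reach-cong (trans (+-identityˡ _) (+-identityʳ d))
      (reach-trans (reach-same (same-onEdge x)) (reach-trans r (reach-same (same-sym (same-onEdge y)))))

    BothArcs : (x y : Point graph) → Set
    BothArcs x y = Reach x y (position y - position x) × Reach x y (L - (position y - position x))

    -- Walk forwards from `y` to the copy of `x` one turn later, then reverse the path.
    wrapAround : ∀ x y → toℕ (edgeOf y) ℕ.< toℕ (edgeOf x) ℕ.+ n → Reach x y (L - (position y - position x))
    wrapAround x y ey<ex+n = reach-onEdge (reach-sym (reach-cong
      (begin
        mark (ex ℕ.+ n) + offset x - position y + 0#  ≈⟨ +-identityʳ _ ⟩
        mark (ex ℕ.+ n) + offset x - position y  ≈⟨ +-congʳ (+-congʳ (mark-+n ex)) ⟩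
        mark ex + L + offset x - position y
          ≈⟨ solve 4 (λ m l o p → m :+ l :+ o :- p := l :- (p :- (m :+ o))) refl (mark ex) L (offset x) (position y) ⟩
        L - (position y - position x)            ∎)
      (reach-trans
        (reach-line ey<ex+n {0≤t = 0≤offset x} {t≤w = ≤-trans (offset≤′ x) (≤-reflexive (reflexive (≡.cong edgeLength (≡.sym (edge-+n ex)))))})
        (reach-same (≡⇒SamePoint (edge-+n ex) refl)))))
      where
      open SetoidReasoning setoid
      ex = toℕ (edgeOf x)

    bothArcs-< : ∀ x y → toℕ (edgeOf x) ℕ.< toℕ (edgeOf y) → BothArcs x y
    bothArcs-< x y ex<ey = reach-onEdge (reach-line ex<ey)
      , wrapAround x y (ℕ.<-≤-trans (toℕ<n (edgeOf y)) (ℕ.m≤n+m n _))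

    bothArcs-≡ : ∀ x y → toℕ (edgeOf x) ≡ toℕ (edgeOf y) → offset x ≤ offset y → BothArcs x y
    bothArcs-≡ x y ex≡ey ox≤oy = reach-onEdge (reach-cong eq
          (reach-trans (reach-same (≡⇒SamePoint (≡.cong edge ex≡ey) refl))
            (reach-segment {0≤s = 0≤offset x} {≤-trans ox≤oy (offset≤′ y)})))
      , wrapAround x y (ℕ.<-≤-trans (toℕ<n (edgeOf y)) (ℕ.m≤n+m n _))
      where
      open SetoidReasoning setoid
      eq = begin
        0# + ∣ offset y - offset x ∣  ≈⟨ +-identityˡ _ ⟩
        ∣ offset y - offset x ∣       ≈⟨ 0≤x⇒∣x∣≈x (x≤y⇒0≤y-x ox≤oy) ⟩
        offset y - offset x
          ≈⟨ solve 3 (λ m s t → t :- s := m :+ t :- (m :+ s)) refl (mark (toℕ (edgeOf y))) (offset x) (offset y) ⟩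
        position y - (mark (toℕ (edgeOf y)) + offset x)  ≡⟨ ≡.cong (λ j → position y - (mark j + offset x)) ex≡ey ⟨
        position y - position x       ∎

    bothArcs : ∀ x y → BothArcs x y ⊎ BothArcs y x
    bothArcs x y with ℕ.<-cmp (toℕ (edgeOf x)) (toℕ (edgeOf y)) | total (offset x) (offset y)
    ... | tri< ex<ey _ _ | _         = inj₁ (bothArcs-< x y ex<ey)
    ... | tri> _ _ ey<ex | _         = inj₂ (bothArcs-< y x ey<ex)
    ... | tri≈ _ ex≡ey _ | inj₁ x≤y  = inj₁ (bothArcs-≡ x y ex≡ey x≤y)
    ... | tri≈ _ ex≡ey _ | inj₂ y≤x  = inj₂ (bothArcs-≡ y x (≡.sym ex≡ey) y≤x)

    -- `arc` selects one of the two paths. The absolute value is resolved because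
    -- `position y - position x` is the length of a path, hence nonnegative.
    bothArcs⇒reach-circ : ∀ x y → BothArcs x y → Reach x y (circ x y)
    bothArcs⇒reach-circ x y (r₁ , r₂) with arc-sel (position x - position y)
    ... | inj₁ eq = reach-cong (trans ∣∣≈ (sym eq)) r₁
      where
      ∣∣≈ = trans (sym (0≤x⇒∣x∣≈x (reach⇒0≤ r₁))) (∣x-y∣≈∣y-x∣ _ _)
    ... | inj₂ eq = reach-cong (trans (+-congˡ (-‿cong ∣∣≈)) (sym eq)) r₂
      where
      ∣∣≈ = trans (sym (0≤x⇒∣x∣≈x (reach⇒0≤ r₁))) (∣x-y∣≈∣y-x∣ _ _)

    reach-circ : ∀ x y → Reach x y (circ x y)
    reach-circ x y with bothArcs x y
    ... | inj₁ r = bothArcs⇒reach-circ x y r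
    ... | inj₂ r = reach-cong (circ-sym y x) (reach-sym (bothArcs⇒reach-circ y x r))

-- Distance and diameter after the fusion

module FusedCycle
  (R : Reals) (L : Reals.ℝ R) (G : MetricGraphs.Cycle R L) {w : ℕ}
  (p : Fin (suc w) → MetricGraphs.Point R (MetricGraphs.MetricGraph.graph (MetricGraphs.Cycle.metricGraph G))) where
  open RealProperties R
  open MetricGraphProperties R
  open CycleProperties R L G
  open Cycle G using (metricGraph)
  open MetricGraph metricGraph using (graph)

  fused : MetricGraph
  fused = fuse metricGraph p

  gluedPairs : List (Point graph × Point graph)
  gluedPairs = tabulate (λ i → p zero , p i) ++ []

  open Glued gluedPairs

  opaque
    nearest : Point graph → Fin (suc w)
    nearest x = proj₁ (minimiser (λ i → circ x (p i)))

    nearest-minimises : ∀ x i → circ x (p (nearest x)) ≤ circ x (p i)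
    nearest-minimises x = proj₂ (minimiser (λ i → circ x (p i)))

  height : Point graph → ℝ
  height x = circ x (p (nearest x))

  height≤circ : ∀ x i → height x ≤ circ x (p i)
  height≤circ = nearest-minimises

  0≤height : ∀ x → 0# ≤ height x
  0≤height x = 0≤circ x (p (nearest x))

  height-fused : ∀ i → height (p i) ≈ 0#
  height-fused i = antisym (≤-trans (height≤circ (p i) i) (circ-self (p i))) (0≤height (p i))

  distance : Point graph → Point graph → ℝ
  distance x y = circ x y ⊓ (height x + height y)

  -- Since `height y` is at most `circ y (p i)`, the detour through the fused point always wins. The
  -- result is independent of `i`, which is the compatibility with the gluing.
  distance-fused : ∀ i y → distance (p i) y ≈ height y
  distance-fused i y = antisym
    (≤-trans (x⊓y≤y _ _) (≤-reflexive eq))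
    (⊓-glb (≤-trans (height≤circ y i) (≤-reflexive (circ-sym y (p i)))) (≤-reflexive (sym eq)))
    where
    eq : height (p i) + height y ≈ height y
    eq = trans (+-congʳ (height-fused i)) (+-identityˡ _)

  ∈-gluedPairs⁻ : ∀ {xy} → xy ∈ gluedPairs → ∃[ i ] xy ≡ (p zero , p i)
  ∈-gluedPairs⁻ xy∈ = [ ∈-tabulate⁻ , (λ ()) ]′ (∈-++⁻ (tabulate (λ i → p zero , p i)) xy∈)

  distance-glued : ∀ {x y} → ∃[ i ] (x , y) ≡ (p zero , p i) → ∀ z → distance x z ≈ distance y z
  distance-glued (i , ≡.refl) z = trans (distance-fused zero z) (sym (distance-fused i z))

  -- The chosen nearest fused points of `x` and `y` may differ, so the heights are compared by
  -- minimality in both directions.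
  distance-cong : ∀ {x y} → (∀ z → circ x z ≈ circ y z) → ∀ z → distance x z ≈ distance y z
  distance-cong {x} {y} x≈y z = ⊓-cong (x≈y z) (+-congʳ (antisym
    (≤-trans (height≤circ x (nearest y)) (≤-reflexive (x≈y (p (nearest y)))))
    (≤-trans (height≤circ y (nearest x)) (≤-reflexive (sym (x≈y (p (nearest x))))))))

  height-lipschitz : ∀ e s t {0≤s s≤w 0≤t t≤w} →
                     height (on e s 0≤s s≤w) ≤ height (on e t 0≤t t≤w) + ∣ t - s ∣
  height-lipschitz e s t {0≤s} {s≤w} {0≤t} {t≤w} =
    ≤-trans (height≤circ (on e s 0≤s s≤w) i) (circ-lipschitz (p i) e s t {0≤s} {s≤w} {0≤t} {t≤w})
    where i = nearest (on e t 0≤t t≤w)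

  distance-lipschitz : ∀ z e s t {0≤s s≤w 0≤t t≤w} →
                       distance (on e s 0≤s s≤w) z ≤ distance (on e t 0≤t t≤w) z + ∣ t - s ∣
  distance-lipschitz z e s t {0≤s} {s≤w} {0≤t} {t≤w} = ≤⊓+
    (≤-trans (x⊓y≤x _ _) (circ-lipschitz z e s t {0≤s} {s≤w} {0≤t} {t≤w}))
    (≤-trans (x⊓y≤y _ _) (linear (height-lipschitz e s t {0≤s} {s≤w} {0≤t} {t≤w})
      (solve 4 (λ a b u z → b :+ z :+ u :+ a := a :+ z :+ (b :+ u)) refl
        (height (on e s 0≤s s≤w)) (height (on e t 0≤t t≤w)) ∣ t - s ∣ (height z))))

  distance-respects : ∀ z x y → (x , y) ∈ gluedPairs ⊎ (∀ v → circ x v ≈ circ y v) → distance x z ≈ distance y z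
  distance-respects z x y (inj₁ xy∈) = distance-glued {x} {y} (∈-gluedPairs⁻ xy∈) z
  distance-respects z x y (inj₂ x≈y) = distance-cong {x} {y} x≈y z

  distance-potential : ∀ z → Potential (λ x → distance x z)
  distance-potential z = record
    { respects  = λ {x} {y} x∼y → distance-respects z x y (circ-respects {gluedPairs} {x} {y} x∼y)
    ; lipschitz = λ e s t {0≤s} {s≤w} {0≤t} {t≤w} → distance-lipschitz z e s t {0≤s} {s≤w} {0≤t} {t≤w}
    }

  distance-self : ∀ x → distance x x ≤ 0#
  distance-self x = ≤-trans (x⊓y≤x _ _) (circ-self x)

  distance≤length : ∀ {x y} (γ : Path fused x y) → distance x y ≤ length γ
  distance≤length {x} {y} γ = linear (potential≤length γ ⊕ distance-self y)
    (solve 3 (λ d e l → l :+ (d :+ e) := d :+ (e :+ l :+ con ℤ.0ℤ)) refl (distance x y) (distance y y) (length γ))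
    where open Potential (distance-potential y)

  same-fused : ∀ i → SamePoint fused (p zero) (p i)
  same-fused i = Eq.return (gluing (∈-++⁺ˡ (∈-tabulate⁺ {f = λ i → p zero , p i} i)))

  reach-distance : ∀ x y → Reach x y (distance x y)
  reach-distance x y = [ (λ eq → reach-cong (sym eq) (reach-circ x y)) , (λ eq → reach-cong (sym eq) throughFused) ]′
    (⊓-sel (circ x y) (height x + height y))
    where
    throughFused : Reach x y (height x + height y)
    throughFused = reach-cong (+-congˡ (trans (+-identityˡ _) (circ-sym (p (nearest y)) y)))
      (reach-trans (reach-circ x (p (nearest x)))
        (reach-trans (reach-same (same-trans (same-sym (same-fused (nearest x))) (same-fused (nearest y))))
          (reach-circ (p (nearest y)) y)))

  isDistance : ∀ x y → IsDistance fused x y (distance x y)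
  isDistance x y = reach-distance x y , distance≤length

  distance-sym : ∀ x y → distance x y ≈ distance y x
  distance-sym x y = ⊓-cong (circ-sym x y) (+-comm _ _)

  distance-isDiameter : ∀ {D} → (∀ x y → distance x y ≤ D) → (∃[ x ] ∃[ y ] D ≤ distance x y) → IsDiameter fused D
  distance-isDiameter ≤D (x , y , D≤) =
      (x , y , reach-cong D≈ (reach-distance x y) , λ γ → ≤-trans D≤ (distance≤length γ))
    , λ x y → distance x y , isDistance x y , ≤D x y
    where
    D≈ : distance x y ≈ _
    D≈ = antisym (≤D x y) D≤

  -- The fused points in the order in which they occur along the cycle, the
  -- first one being repeated at the end one full turn later.
  record Enumeration : Set where
    field
      index    : ℕ → Fin (suc w)
      cut      : ℕ → ℝ
      cut-lift : ∀ {i} → i ℕ.≤ suc w → Lift (p (index i)) (cut i)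
      cut-mono : ∀ {i} → i ℕ.≤ w → cut i ≤ cut (suc i)
      0≤cut    : 0# ≤ cut 0
      cut≤L    : cut w ≤ L
      closes   : cut (suc w) ≈ cut 0 + L
      complete : ∀ j → ∃[ i ] i ℕ.≤ w × index i ≡ j

    cut-mono-+ : ∀ d {i} → d ℕ.+ i ℕ.≤ suc w → cut i ≤ cut (d ℕ.+ i)
    cut-mono-+ zero    _       = ≤-refl
    cut-mono-+ (suc d) d+i≤w = ≤-trans (cut-mono-+ d (ℕ.<⇒≤ d+i≤w)) (cut-mono (ℕ.≤-pred d+i≤w))

    cut-mono-≤ : ∀ {i j} → i ℕ.≤ j → j ℕ.≤ suc w → cut i ≤ cut j
    cut-mono-≤ {i} {j} i≤j j≤w = ≤-trans
      (cut-mono-+ (j ℕ.∸ i) (≡.subst (ℕ._≤ suc w) (≡.sym (ℕ.m∸n+n≡m i≤j)) j≤w))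
      (≤-reflexive (reflexive (≡.cong cut (ℕ.m∸n+n≡m i≤j))))

    -- All cuts lie within one turn. This bounds the complementary way round whenever `≤circ` is
    -- applied to cuts and centres.
    cut-turn : ∀ {i j} → i ℕ.≤ suc w → j ℕ.≤ suc w → cut j ≤ cut i + L
    cut-turn i≤w j≤w = ≤-trans (cut-mono-≤ j≤w ℕ.≤-refl)
      (≤-trans (≤-reflexive closes) (cut-mono-≤ ℕ.z≤n i≤w ⊕ ≤-refl))

    radius : ℕ → ℝ
    radius i = half (cut (suc i) - cut i)

    radius+radius : ∀ i → radius i + radius i ≈ cut (suc i) - cut i
    radius+radius i = half+half (cut (suc i) - cut i)

    0≤radius : ∀ {i} → i ℕ.≤ w → 0# ≤ radius i
    0≤radius {i} i≤w = x+x≤y+y⇒x≤y (≤-trans (≤-reflexive (+-identityˡ 0#))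
      (≤-trans (x≤y⇒0≤y-x (cut-mono i≤w)) (≤-reflexive (sym (radius+radius i)))))

    centre : ℕ → ℝ
    centre i = cut i + radius i

    record InGap (x : Point graph) (i : ℕ) : Set where
      field
        at     : ℝ
        lift   : Lift x at
        cut≤at : cut i ≤ at
        at≤cut : at ≤ cut (suc i)

    locate : ∀ x → ∃[ i ] InGap x (toℕ {suc w} i)
    locate x with total (cut 0) (position x)
    ... | inj₁ ≤x =
      let i , cut≤at , at≤cut = bracket cut w ≤x
            (linear (position≤L x ⊕ 0≤cut ⊕ ≤-reflexive (sym closes))
              (solve 4 (λ c₀ c x l → c :+ (x :+ con ℤ.0ℤ :+ (c₀ :+ l)) := x :+ (l :+ c₀ :+ c)) refl
                (cut 0) (cut (suc w)) (position x) L))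
      in i , record { at = position x ; lift = inj₁ refl ; cut≤at = cut≤at ; at≤cut = at≤cut }
    -- A point before the first cut belongs to the last gap, one turn later.
    ... | inj₂ x≤ = Fin.fromℕ w , ≡.subst (InGap x) (≡.sym (toℕ-fromℕ w)) (record
      { at     = position x + L
      ; lift   = inj₂ refl
      ; cut≤at = linear (cut≤L ⊕ 0≤position x)
                   (solve 3 (λ c x l → x :+ l :+ (c :+ con ℤ.0ℤ) := c :+ (l :+ x)) refl (cut w) (position x) L)
      ; at≤cut = ≤-trans (x≤ ⊕ ≤-refl) (≤-reflexive (sym closes))
      })

    module _ {x i} (i≤w : i ℕ.≤ w) (x∈i : InGap x i) where
      open InGap x∈i

      height≤left : height x ≤ at - cut i
      height≤left = ≤-trans (height≤circ x (index i)) (≤-trans (≤-reflexive (circ-sym x (p (index i))))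
        (circ≤lift {p (index i)} {x} (cut-lift (ℕ.m≤n⇒m≤1+n i≤w)) lift cut≤at))

      height≤right : height x ≤ cut (suc i) - at
      height≤right = ≤-trans (height≤circ x (index (suc i)))
        (circ≤lift {x} {p (index (suc i))} lift (cut-lift (ℕ.s≤s i≤w)) at≤cut)

      height≤radius : height x ≤ radius i
      height≤radius = x+x≤y+y⇒x≤y (linear (height≤left ⊕ height≤right ⊕ ≤-reflexive (sym (radius+radius i)))
        (solve 5 (λ h r a c d → r :+ r :+ (h :+ h :+ (d :- c)) := h :+ h :+ (a :- c :+ (d :- a) :+ (r :+ r))) refl
          (height x) (radius i) at (cut i) (cut (suc i))))

    -- Together with the fused point, the gap is a circle of length
    -- cut (suc i) - cut i, on which x and y divide the circumference in two.
    distance≤radius′ : ∀ {x y i} → i ℕ.≤ w → (x∈i : InGap x i) (y∈i : InGap y i) →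
                       InGap.at x∈i ≤ InGap.at y∈i → distance x y ≤ radius i
    distance≤radius′ {x} {y} {i} i≤w x∈i y∈i x≤y = x+x≤y+y⇒x≤y (linear
      (x⊓y≤x (circ x y) (height x + height y) ⊕ circ≤lift {x} {y} (lift x∈i) (lift y∈i) x≤y
        ⊕ x⊓y≤y (circ x y) (height x + height y) ⊕ height≤left i≤w x∈i ⊕ height≤right i≤w y∈i
        ⊕ ≤-reflexive (sym (radius+radius i)))
      (solve 9 (λ d c hx hy a b r u v →
          r :+ r :+ (d :+ c :+ d :+ hx :+ hy :+ (v :- u)) :=
          d :+ d :+ (c :+ (b :- a) :+ (hx :+ hy) :+ (a :- u) :+ (v :- b) :+ (r :+ r))) refl
        (distance x y) (circ x y) (height x) (height y) (at x∈i) (at y∈i) (radius i) (cut i) (cut (suc i))))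
      where open InGap

    distance≤radius : ∀ {x y i} → i ℕ.≤ w → InGap x i → InGap y i → distance x y ≤ radius i
    distance≤radius {x} {y} i≤w x∈i y∈i with total (InGap.at x∈i) (InGap.at y∈i)
    ... | inj₁ x≤y = distance≤radius′ i≤w x∈i y∈i x≤y
    ... | inj₂ y≤x = ≤-trans (≤-reflexive (distance-sym x y)) (distance≤radius′ i≤w y∈i x∈i y≤x)

    distance≤radius+radius : ∀ {x y i j} → i ℕ.≤ w → j ℕ.≤ w → InGap x i → InGap y j →
                             distance x y ≤ radius i + radius j
    distance≤radius+radius {x} {y} i≤w j≤w x∈i y∈j = ≤-trans (x⊓y≤y (circ x y) (height x + height y))
      (height≤radius i≤w x∈i ⊕ height≤radius j≤w y∈j)

    -- Midpoints of gaps and lower bounds for distances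

    pointOver : ∀ {z} → 0# ≤ z → z ≤ L + L → ∃[ x ] Lift x z
    pointOver {z} 0≤z z≤2L with total z L
    ... | inj₁ z≤L = let x , eq = pointAt 0≤z z≤L in x , inj₁ (sym eq)
    ... | inj₂ L≤z =
      let x , eq = pointAt (x≤y⇒0≤y-x L≤z) (linear z≤2L (solve 2 (λ z l → l :+ z := z :- l :+ (l :+ l)) refl z L))
      in x , inj₂ (linear≈ (sym eq) (solve 3 (λ z x l → x :+ l :+ (z :- l) := z :+ x) refl z (position x) L))

    middle : ∀ {i} → i ℕ.≤ w → ∃[ x ] Lift x (centre i)
    middle {i} i≤w = pointOver
      (+-nonNegative (≤-trans 0≤cut (cut-mono-≤ ℕ.z≤n (ℕ.m≤n⇒m≤1+n i≤w))) (0≤radius i≤w))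
      -- The centre is at most `cut (suc i)`, which is at most `cut 0 + L` and so at most `L + L`.
      (linear (0≤radius i≤w ⊕ ≤-reflexive (radius+radius i) ⊕ cut-turn {0} {suc i} ℕ.z≤n (ℕ.s≤s i≤w)
                ⊕ cut-mono-≤ {0} {w} ℕ.z≤n (ℕ.n≤1+n w) ⊕ cut≤L)
        (solve 6 (λ c d c₀ e r l →
            l :+ l :+ (con ℤ.0ℤ :+ (r :+ r) :+ d :+ c₀ :+ e) := c :+ r :+ (r :+ (d :- c) :+ (c₀ :+ l) :+ e :+ l)) refl
          (cut i) (cut (suc i)) (cut 0) (cut w) (radius i) L))

    -- Every way from the centre to a cut leaves gap `i` through one of its ends and so covers half
    -- of the gap. The cases tell on which side of the centre `cut l` lies.
    radius≤circ : ∀ {i l x} → i ℕ.≤ w → l ℕ.≤ w → Lift x (centre i) → radius i ≤ circ x (p (index l))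
    radius≤circ {i} {l} {x} i≤w l≤w x↑ with ℕ.≤-<-connex l i
    ... | inj₁ l≤i = ≤-trans
      (≤circ {p (index l)} {x} (cut-lift (ℕ.m≤n⇒m≤1+n l≤w)) x↑
        (linear (cut-mono-≤ l≤i (ℕ.m≤n⇒m≤1+n i≤w))
          (solve 3 (λ cl ci r → ci :+ r :- cl :+ cl := r :+ ci) refl (cut l) (cut i) (radius i)))
        (linear (cut-turn {l} {suc i} (ℕ.m≤n⇒m≤1+n l≤w) (ℕ.s≤s i≤w) ⊕ ≤-reflexive (radius+radius i))
          (solve 5 (λ cl ci di r l → l :- (ci :+ r :- cl) :+ (di :+ (r :+ r)) := r :+ (cl :+ l :+ (di :- ci))) refl
            (cut l) (cut i) (cut (suc i)) (radius i) L)))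
      (≤-reflexive (circ-sym (p (index l)) x))
    ... | inj₂ i<l = ≤circ {x} {p (index l)} x↑ (cut-lift (ℕ.m≤n⇒m≤1+n l≤w))
        (linear (cut-mono-≤ i<l (ℕ.m≤n⇒m≤1+n l≤w) ⊕ ≤-reflexive (radius+radius i))
          (solve 4 (λ cl ci di r → cl :- (ci :+ r) :+ (di :+ (r :+ r)) := r :+ (cl :+ (di :- ci))) refl
            (cut l) (cut i) (cut (suc i)) (radius i)))
        (linear (cut-turn {i} {l} (ℕ.m≤n⇒m≤1+n i≤w) (ℕ.m≤n⇒m≤1+n l≤w))
          (solve 4 (λ cl ci r l → l :- (cl :- (ci :+ r)) :+ cl := r :+ (ci :+ l)) refl
            (cut l) (cut i) (radius i) L))

    radius≤height : ∀ {i x} → i ℕ.≤ w → Lift x (centre i) → radius i ≤ height x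
    radius≤height {i} {x} i≤w x↑ = let l , l≤w , eq = complete (nearest x) in
      ≡.subst (λ j → radius i ≤ circ x (p j)) eq (radius≤circ {i} {l} {x} i≤w l≤w x↑)

    -- One arc between the centres contains the right half of gap `i` and the left half of gap `j`;
    -- the other arc contains the two remaining halves. The detour through the fused point costs
    -- both heights.
    radius+radius≤distance : ∀ {i j x y} → i ℕ.< j → j ℕ.≤ w → Lift x (centre i) → Lift y (centre j) →
                             radius i + radius j ≤ distance x y
    radius+radius≤distance {i} {j} {x} {y} i<j j≤w x↑ y↑ = ⊓-glb
      (≤circ {x} {y} x↑ y↑
        (linear (cut-mono-≤ i<j (ℕ.m≤n⇒m≤1+n j≤w) ⊕ ≤-reflexive (radius+radius i))
          (solve 5 (λ ci di cj ri rj → cj :+ rj :- (ci :+ ri) :+ (di :+ (ri :+ ri)) := ri :+ rj :+ (cj :+ (di :- ci))) refl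
            (cut i) (cut (suc i)) (cut j) (radius i) (radius j)))
        (linear (cut-turn {i} {suc j} (ℕ.m≤n⇒m≤1+n i≤w) (ℕ.s≤s j≤w) ⊕ ≤-reflexive (radius+radius j))
          (solve 6 (λ ci cj dj ri rj l → l :- (cj :+ rj :- (ci :+ ri)) :+ (dj :+ (rj :+ rj))
              := ri :+ rj :+ (ci :+ l :+ (dj :- cj))) refl
            (cut i) (cut j) (cut (suc j)) (radius i) (radius j) L)))
      (radius≤height {i} {x} i≤w x↑ ⊕ radius≤height {j} {y} j≤w y↑)
      where
      i≤w : i ℕ.≤ w
      i≤w = ℕ.≤-trans (ℕ.<⇒≤ i<j) j≤w

    radius≤distance : ∀ {i x} l → i ℕ.≤ w → Lift x (centre i) → radius i ≤ distance (p l) x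
    radius≤distance {i} {x} l i≤w x↑ =
      ≤-trans (radius≤height {i} {x} i≤w x↑) (≤-reflexive (sym (distance-fused l x)))

    -- The largest distance between points of the two gaps. The diagonal is special because a loop
    -- of length `radius i + radius i` has diameter `radius i`.
    extent : ℕ → ℕ → ℝ
    extent i j with i ℕ.≟ j
    ... | yes _ = radius i
    ... | no  _ = radius i + radius j

    distance≤extent : ∀ {x y i j} → i ℕ.≤ w → j ℕ.≤ w → InGap x i → InGap y j → distance x y ≤ extent i j
    distance≤extent {i = i} {j} i≤w j≤w x∈i y∈j with i ℕ.≟ j
    ... | yes ≡.refl = distance≤radius i≤w x∈i y∈j
    ... | no  _      = distance≤radius+radius i≤w j≤w x∈i y∈j

    extent≤distance : ∀ i j → i ℕ.≤ w → j ℕ.≤ w → ∃[ x ] ∃[ y ] extent i j ≤ distance x y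
    extent≤distance i j i≤w j≤w with i ℕ.≟ j | middle i≤w | middle j≤w
    ... | yes _ | x , x↑ | _ = p zero , x , radius≤distance {i} {x} zero i≤w x↑
    ... | no i≢j | x , x↑ | y , y↑ with ℕ.<-cmp i j
    ...   | tri< i<j _ _ = x , y , radius+radius≤distance {i} {j} {x} {y} i<j j≤w x↑ y↑
    ...   | tri≈ _ i≡j _ = contradiction i≡j i≢j
    ...   | tri> _ _ j<i = y , x , ≤-trans (≤-reflexive (+-comm _ _))
            (radius+radius≤distance {j} {i} {y} {x} j<i i≤w y↑ x↑)

    extent-≢ : ∀ {i j} → i ≢ j → extent i j ≈ radius i + radius j
    extent-≢ {i} {j} i≢j with i ℕ.≟ j
    ... | yes i≡j = contradiction i≡j i≢j
    ... | no  _   = refl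

    toℕ≤w : ∀ (i : Fin (suc w)) → toℕ i ℕ.≤ w
    toℕ≤w i = ℕ.≤-pred (toℕ<n i)

    pairs : List (Fin (suc w) × Fin (suc w))
    pairs = cartesianProduct (allFin (suc w)) (allFin (suc w))

    widest : ∃[ m ] (∀ {ij} → ij ∈ pairs → extent (toℕ (proj₁ ij)) (toℕ (proj₂ ij)) ≤ extent (toℕ (proj₁ m)) (toℕ (proj₂ m)))
    widest = maximiser (λ (i , j) → extent (toℕ i) (toℕ j)) (zero , zero) pairs

    diameter : ℝ
    diameter = let (i , j) , _ = widest in extent (toℕ i) (toℕ j)

    extent≤diameter : ∀ i j → extent (toℕ {suc w} i) (toℕ {suc w} j) ≤ diameter
    extent≤diameter i j = proj₂ widest (∈-cartesianProduct⁺ (∈-allFin i) (∈-allFin j))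

    isDiameter : IsDiameter fused diameter
    isDiameter = distance-isDiameter
      (λ x y → let i , x∈i = locate x
                   j , y∈j = locate y
               in ≤-trans (distance≤extent (toℕ≤w i) (toℕ≤w j) x∈i y∈j) (extent≤diameter i j))
      (let (i , j) , _ = widest in extent≤distance (toℕ i) (toℕ j) (toℕ≤w i) (toℕ≤w j))

    radius+radius≤diameter : ∀ {i j} → i ℕ.≤ w → j ℕ.≤ w → i ≢ j → radius i + radius j ≤ diameter
    radius+radius≤diameter {i} {j} i≤w j≤w i≢j = ≤-trans (≤-reflexive (sym (extent-≢ i≢j)))
      (≡.subst₂ (λ i j → extent i j ≤ diameter) (toℕ-fromℕ< (ℕ.s≤s i≤w)) (toℕ-fromℕ< (ℕ.s≤s j≤w))
        (extent≤diameter (fromℕ< (ℕ.s≤s i≤w)) (fromℕ< (ℕ.s≤s j≤w))))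

    -- From `m` to `suc m` the left side grows by the gaps `m` and `suc m`, which is twice the sum
    -- of their radii. The pair of the last and the first gap is added in `L≤n*diameter`, where
    -- `1 ≤ w` makes them different.
    cut+cut≤ : ∀ m → m ℕ.≤ w → cut m + cut (suc m) ≤ cut 0 + cut 1 + fromℕ m * (diameter + diameter)
    cut+cut≤ zero    _   = ≤-reflexive (solve 2 (λ c d → c := c :+ con ℤ.0ℤ :* d) refl (cut 0 + cut 1) (diameter + diameter))
    cut+cut≤ (suc m) m<w = linear
      (cut+cut≤ m (ℕ.<⇒≤ m<w) ⊕ ≤-reflexive (sym (radius+radius m)) ⊕ ≤-reflexive (sym (radius+radius (suc m)))
        -- The solver is given `1#` as a variable, so its action as a unit is supplied separately.
        ⊕ r≤D ⊕ r≤D ⊕ ≤-reflexive (sym (*-identityˡ (diameter + diameter))))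
      (solve 10 (λ a₀ a₁ a₂ c₀ c₁ r₀ r₁ d o f →
          c₀ :+ c₁ :+ (o :+ f) :* (d :+ d)
            :+ (a₀ :+ a₁ :+ (a₁ :- a₀) :+ (a₂ :- a₁) :+ (r₀ :+ r₁) :+ (r₀ :+ r₁) :+ (d :+ d)) :=
          a₁ :+ a₂ :+ (c₀ :+ c₁ :+ f :* (d :+ d) :+ (r₀ :+ r₀) :+ (r₁ :+ r₁) :+ d :+ d :+ o :* (d :+ d))) refl
        (cut m) (cut (suc m)) (cut (suc (suc m))) (cut 0) (cut 1) (radius m) (radius (suc m)) diameter 1# (fromℕ m))
      where
      r≤D : radius m + radius (suc m) ≤ diameter
      r≤D = radius+radius≤diameter (ℕ.<⇒≤ m<w) m<w (ℕ.<⇒≢ (ℕ.n<1+n m))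

    -- The sum of all cyclically consecutive pairs of gaps is 2 L.
    L≤n*diameter : 1 ℕ.≤ w → L ≤ fromℕ (suc w) * diameter
    L≤n*diameter 1≤w = x+x≤y+y⇒x≤y (linear
      (cut+cut≤ w ℕ.≤-refl ⊕ ≤-reflexive (sym (radius+radius w)) ⊕ ≤-reflexive (sym (radius+radius 0))
        ⊕ r≤D ⊕ r≤D ⊕ ≤-reflexive (sym closes) ⊕ ≤-reflexive (sym closes)
        ⊕ ≤-reflexive (sym (*-identityˡ (diameter + diameter))))
      (solve 10 (λ a a′ c₀ c₁ r r₀ d o f l →
          (o :+ f) :* d :+ (o :+ f) :* d :+ (a :+ a′ :+ (a′ :- a) :+ (c₁ :- c₀)
            :+ (r :+ r₀) :+ (r :+ r₀) :+ (c₀ :+ l) :+ (c₀ :+ l) :+ (d :+ d)) :=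
          l :+ l :+ (c₀ :+ c₁ :+ f :* (d :+ d) :+ (r :+ r) :+ (r₀ :+ r₀) :+ d :+ d :+ a′ :+ a′ :+ o :* (d :+ d))) refl
        (cut w) (cut (suc w)) (cut 0) (cut 1) (radius w) (radius 0) diameter 1# (fromℕ w) L))
      where
      r≤D : radius w + radius 0 ≤ diameter
      r≤D = radius+radius≤diameter ℕ.≤-refl ℕ.z≤n (λ w≡0 → ℕ.<⇒≢ 1≤w (≡.sym w≡0))

    L/n≤diameter : 1 ℕ.≤ w → L / fromℕ (suc w) ≤ diameter
    L/n≤diameter 1≤w = /-≤ (0<fromℕ-suc w) (L≤n*diameter 1≤w)

    module _ {a} (gap≈a : ∀ {i} → i ℕ.≤ w → cut (suc i) - cut i ≈ a) where

      radius+radius≤ : ∀ {i j} → i ℕ.≤ w → j ℕ.≤ w → radius i + radius j ≤ a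
      radius+radius≤ {i} {j} i≤w j≤w = x+x≤y+y⇒x≤y (≤-reflexive (linear≈
        (radius+radius i ⟨ +-cong ⟩ radius+radius j ⟨ +-cong ⟩ gap≈a i≤w ⟨ +-cong ⟩ gap≈a j≤w)
        (solve 5 (λ r s a u v → a :+ a :+ (r :+ r :+ (s :+ s) :+ u :+ v) := r :+ s :+ (r :+ s) :+ (u :+ v :+ a :+ a)) refl
          (radius i) (radius j) a (cut (suc i) - cut i) (cut (suc j) - cut j))))

      extent≤ : ∀ {i j} → i ℕ.≤ w → j ℕ.≤ w → extent i j ≤ a
      extent≤ {i} {j} i≤w j≤w with i ℕ.≟ j
      ... | no  _ = radius+radius≤ i≤w j≤w
      ... | yes _ = linear (radius+radius≤ i≤w i≤w ⊕ 0≤radius i≤w)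
        (solve 2 (λ r a → a :+ (r :+ r :+ con ℤ.0ℤ) := r :+ (a :+ r)) refl (radius i) a)

      diameter≤ : diameter ≤ a
      diameter≤ = let (i , j) , _ = widest in extent≤ {toℕ i} {toℕ j} (toℕ≤w i) (toℕ≤w j)

-- Enumerating arbitrary and equally spaced points

module Enumerations (R : Reals) (L : Reals.ℝ R) (G : MetricGraphs.Cycle R L) where
  open RealProperties R
  open MetricGraphProperties R
  open CycleProperties R L G
  open Cycle G using (metricGraph)
  open MetricGraph metricGraph using (graph)

  module Sorted {w : ℕ} (p : Fin (suc w) → Point graph) where
    open FusedCycle R L G p

    place : Fin (suc w) → ℝ
    place i = position (p i)

    open Sort (On.decTotalOrder decTotalOrder place)

    module _ {d : ℝ} where

      nth-lift : ∀ {i} xs j → d ≈ place i + L → Lift (p (nth i xs j)) (nth d (List.map place xs) j)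
      nth-lift []       j       d≈ = inj₂ d≈
      nth-lift (x ∷ xs) zero    d≈ = inj₁ refl
      nth-lift (x ∷ xs) (suc j) d≈ = nth-lift xs j d≈

      -- The last admissible `j` compares the final entry with the default `d`.
      nth-mono : (∀ i → place i ≤ d) → ∀ {xs} → Linked (λ i j → place i ≤ place j) xs →
                 ∀ {j} → j ℕ.< List.length xs → nth d (List.map place xs) j ≤ nth d (List.map place xs) (suc j)
      nth-mono ≤d [-]         {zero}  _         = ≤d _
      nth-mono ≤d (x≤y ∷ _)   {zero}  _         = x≤y
      nth-mono ≤d (_ ∷ xs↗)   {suc j} (ℕ.s≤s j<) = nth-mono ≤d xs↗ j<
      nth-mono ≤d [-]         {suc j} (ℕ.s≤s ())

      nth≤L : ∀ xs {j} → j ℕ.< List.length xs → nth d (List.map place xs) j ≤ L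
      nth≤L (x ∷ xs) {zero}  _          = position≤L (p x)
      nth≤L (x ∷ xs) {suc j} (ℕ.s≤s j<) = nth≤L xs j<

    enumerate : ∀ xs → List.length xs ≡ suc w → (∀ i → i ∈ xs) → Linked (λ i j → place i ≤ place j) xs → Enumeration
    enumerate (x ∷ xs) length≡ ∈xs xs↗ = record
      -- At `suc w` both lists are exhausted, and the defaults of `nth` supply the first point
      -- again, one turn later.
      { index    = nth x (x ∷ xs)
      ; cut      = nth (place x + L) (List.map place (x ∷ xs))
      ; cut-lift = λ {i} _ → nth-lift (x ∷ xs) i refl
      ; cut-mono = λ {i} i≤w → nth-mono (λ i → linear (position≤L (p i) ⊕ 0≤position (p x))
          (solve 3 (λ i x l → x :+ l :+ (i :+ con ℤ.0ℤ) := i :+ (l :+ x)) refl (place i) (place x) L)) xs↗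
          (≡.subst (i ℕ.<_) (≡.sym length≡) (ℕ.s≤s i≤w))
      ; 0≤cut    = 0≤position (p x)
      ; cut≤L    = nth≤L (x ∷ xs) (ℕ.≤-reflexive (≡.sym length≡))
      ; closes   = reflexive (≡.trans
          (≡.cong (nth (place x + L) (List.map place (x ∷ xs))) (≡.sym (≡.trans (length-map place (x ∷ xs)) length≡)))
          (nth-length (place x + L) (List.map place (x ∷ xs))))
      ; complete = λ j → let i , i< , eq = ∈⇒nth x (∈xs j) in i , ℕ.≤-pred (≡.subst (i ℕ.<_) length≡ i<) , eq
      }

    sorted : Enumeration
    sorted = enumerate (sort (allFin (suc w)))
      (≡.trans (↭-length (sort-↭ (allFin (suc w)))) (length-tabulate {n = suc w} (λ i → i)))
      (λ i → ∈-resp-↭ (↭-sym (sort-↭ (allFin (suc w)))) (∈-allFin i))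
      (sort-↗ (allFin (suc w)))

  module EquallySpaced (0<L : 0# < L) (w : ℕ) where

    step : ℝ
    step = L / fromℕ (suc w)

    n*step≈L : fromℕ (suc w) * step ≈ L
    n*step≈L = begin
      fromℕ (suc w) * (L * fromℕ (suc w) ⁻¹)  ≈⟨ solve 3 (λ n l i → n :* (l :* i) := l :* (n :* i)) refl (fromℕ (suc w)) L (fromℕ (suc w) ⁻¹) ⟩
      L * (fromℕ (suc w) * fromℕ (suc w) ⁻¹)  ≈⟨ *-congˡ (*-inverseʳ _ (λ n≈0 → proj₂ (0<fromℕ-suc w) (sym n≈0))) ⟩
      L * 1#                                  ≈⟨ *-identityʳ L ⟩
      L                                       ∎
      where open SetoidReasoning setoid

    0≤step : 0# ≤ step
    0≤step = *-nonNegative (proj₁ 0<L) (⁻¹-nonNegative (0<fromℕ-suc w))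

    step≰0 : ¬ (step ≤ 0#)
    step≰0 step≤0 = proj₂ 0<L (begin
      0#                    ≈⟨ zeroʳ (fromℕ (suc w)) ⟨
      fromℕ (suc w) * 0#    ≈⟨ *-congˡ (antisym 0≤step step≤0) ⟩
      fromℕ (suc w) * step  ≈⟨ n*step≈L ⟩
      L                     ∎)
      where open SetoidReasoning setoid

    spot : ℕ → ℝ
    spot i = fromℕ i * step

    spot-suc : ∀ i → spot (suc i) ≈ spot i + step
    spot-suc i = trans (distribʳ step 1# (fromℕ i)) (trans (+-congʳ (*-identityˡ step)) (+-comm _ _))

    spot-mono-+ : ∀ d i → spot i ≤ spot (d ℕ.+ i)
    spot-mono-+ zero    i = ≤-refl
    spot-mono-+ (suc d) i = ≤-trans (spot-mono-+ d i) (linear (0≤step ⊕ ≤-reflexive (sym (spot-suc (d ℕ.+ i))))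
      (solve 3 (λ x y s → y :+ (con ℤ.0ℤ :+ (x :+ s)) := x :+ (s :+ y)) refl (spot (d ℕ.+ i)) (spot (suc d ℕ.+ i)) step))

    spot-mono : ∀ {i j} → i ℕ.≤ j → spot i ≤ spot j
    spot-mono {i} {j} i≤j = ≤-trans (spot-mono-+ (j ℕ.∸ i) i) (≤-reflexive (reflexive (≡.cong spot (ℕ.m∸n+n≡m i≤j))))

    spot-0 : spot 0 ≈ 0#
    spot-0 = zeroˡ step

    0≤spot : ∀ i → 0# ≤ spot i
    0≤spot i = *-nonNegative (0≤fromℕ i) 0≤step

    spot≤L : ∀ {i} → i ℕ.≤ suc w → spot i ≤ L
    spot≤L i≤n = ≤-trans (spot-mono i≤n) (≤-reflexive n*step≈L)

    opaque
      points : Fin (suc w) → Point graph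
      points i = proj₁ (pointAt (0≤spot (toℕ i)) (spot≤L (ℕ.<⇒≤ (toℕ<n i))))

      position-points : ∀ i → position (points i) ≈ spot (toℕ i)
      position-points i = proj₂ (pointAt (0≤spot (toℕ i)) (spot≤L (ℕ.<⇒≤ (toℕ<n i))))

    -- Forwards, the two spots are at least one step apart. The other way round contains the step
    -- after spot `j`, which ends at `L` or before.
    step≤circ : ∀ {i j} → toℕ i ℕ.< toℕ j → step ≤ circ (points i) (points j)
    step≤circ {i} {j} i<j = ≤circ {points i} {points j}
      (inj₁ (sym (position-points i))) (inj₁ (sym (position-points j)))
      (linear (spot-mono i<j ⊕ ≤-reflexive (sym (spot-suc (toℕ i))))
        (solve 4 (λ x x′ y s → y :- x :+ (x′ :+ (x :+ s)) := s :+ (y :+ x′)) refl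
          (spot (toℕ i)) (spot (suc (toℕ i))) (spot (toℕ j)) step))
      (linear (spot≤L (toℕ<n j) ⊕ ≤-reflexive (sym (spot-suc (toℕ j))) ⊕ 0≤spot (toℕ i))
        (solve 5 (λ x y y′ s l → l :- (y :- x) :+ (y′ :+ (y :+ s) :+ con ℤ.0ℤ) := s :+ (l :+ y′ :+ x)) refl
          (spot (toℕ i)) (spot (toℕ j)) (spot (suc (toℕ j))) step L))

    -- Used for distinctness: equal points would have `circ` at most 0.
    circ-same : ∀ {x y} → SamePoint metricGraph x y → ∀ z → circ x z ≈ circ y z
    circ-same x~y z = Eq.gfold isEquivalence (λ x → circ x z) (λ x∼y → [ (λ ()) , (λ eq → eq z) ]′ (circ-respects x∼y)) x~y

    circ-same≤0 : ∀ {x y} → SamePoint metricGraph x y → circ x y ≤ 0#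
    circ-same≤0 {x} {y} x~y = ≤-trans (≤-reflexive (circ-same x~y y)) (circ-self y)

    points-distinct : Distinct metricGraph points
    points-distinct i j i≢j i~j with ℕ.<-cmp (toℕ i) (toℕ j)
    ... | tri< i<j _ _ = step≰0 (≤-trans (step≤circ i<j) (circ-same≤0 i~j))
    ... | tri≈ _ i≡j _ = i≢j (toℕ-injective i≡j)
    ... | tri> _ _ j<i = step≰0 (≤-trans (step≤circ j<i) (≤-trans (≤-reflexive (circ-sym (points j) (points i))) (circ-same≤0 i~j)))

    open FusedCycle R L G points

    spot-lift : ∀ {i} → i ℕ.≤ suc w → Lift (points (i mod suc w)) (spot i)
    spot-lift {i} i≤n with ℕ.m≤n⇒m<n∨m≡n i≤n
    ... | inj₁ i<n    = inj₁ (sym (trans (position-points (i mod suc w))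
            (reflexive (≡.cong spot (≡.trans (toℕ-fromℕ< (m%n<n i (suc w))) (m<n⇒m%n≡m i<n))))))
    -- The index has returned to 0, while the spot has advanced by a full turn.
    ... | inj₂ ≡.refl = inj₂ (begin
            spot (suc w)                                ≈⟨ n*step≈L ⟩
            L                                           ≈⟨ +-identityˡ L ⟨
            0# + L                                      ≈⟨ +-congʳ spot-0 ⟨
            spot 0 + L                                  ≡⟨ ≡.cong (λ i → spot i + L) (≡.trans (toℕ-fromℕ< (m%n<n (suc w) (suc w))) (n%n≡0 (suc w))) ⟨
            spot (toℕ (suc w mod suc w)) + L            ≈⟨ +-congʳ (position-points (suc w mod suc w)) ⟨
            position (points (suc w mod suc w)) + L     ∎)
      where open SetoidReasoning setoid

    enumeration : Enumeration
    enumeration = record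
      { index    = _mod suc w
      ; cut      = spot
      ; cut-lift = spot-lift
      ; cut-mono = λ {i} _ → spot-mono (ℕ.n≤1+n i)
      ; 0≤cut    = 0≤spot 0
      ; cut≤L    = spot≤L (ℕ.n≤1+n w)
      ; closes   = trans n*step≈L (trans (sym (+-identityˡ L)) (+-congʳ (sym spot-0)))
      ; complete = λ i → toℕ i , ℕ.≤-pred (toℕ<n i) , mod-toℕ i
      }

    open Enumeration enumeration

    -- Equal gaps give the upper bound; the lower bound is the one valid for every enumeration.
    diameter≈step : 1 ℕ.≤ w → diameter ≈ step
    diameter≈step 1≤w = antisym
      (diameter≤ λ {i} _ → linear≈ (spot-suc i)
        (solve 3 (λ x y s → s :+ y := y :- x :+ (x :+ s)) refl (spot i) (spot (suc i)) step))
      (L/n≤diameter 1≤w)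

    isDiameter-step : 1 ℕ.≤ w → IsDiameter (fuse metricGraph points) step
    isDiameter-step 1≤w = isDiameter-cong (diameter≈step 1≤w) isDiameter

mainTheorem8 : (R : Reals) →
    let open Reals R
        open MetricGraphs R
    in (L : ℝ) → 0# < L → (w : ℕ) → 1 ℕ.≤ w → (G : Cycle L) →
       IsMinimumFusedDiameter (Cycle.metricGraph G) w (L / fromℕ (suc w))
mainTheorem8 R L 0<L w 1≤w G =
    (points , points-distinct , isDiameter-step 1≤w)
  , λ p _ → let open Sorted p
                open FusedCycle R L G p using (module Enumeration)
                open Enumeration sorted
            in diameter , isDiameter , L/n≤diameter 1≤w
  where
  open Enumerations R L G
  open EquallySpaced 0<L w
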